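{- Every outerplanar graph $G$ satisfies $G \in B_2^m$, i.e. $G$ has a $B_2^m$-EPG representation.
   Context: Consider a rectangular grid of horizontal and vertical grid lines; a grid edge is the segment of a grid line between two consecutive grid points. A path on the grid is a sequence of grid points in which consecutive points are joined by grid edges; a bend point is an interior point of the path at which a horizontal grid edge meets a vertical grid edge of the path. Two paths intersect if they share at least one grid edge. An EPG representation of a graph $G$ is a set of paths on a grid, one per vertex, such that two vertices are adjacent in $G$ iff their paths share a grid edge. A $B_k$-EPG representation is an EPG representation in which every path has at most $k$ bends; a path is monotonic if it is ascending in both columns and rows (traversed from one end it only moves rightwards and upwards), and a $B_k^m$-EPG representation is a $B_k$-EPG representation in which every path is monotonic. $B_k$ (resp. $B_k^m$) denotes the class of graphs having a $B_k$-EPG (resp. $B_k^m$-EPG) representation. -}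

module Defs where

open import Data.Bool.Base using (Bool; false; T; if_then_else_; _xor_)
open import Data.Bool.Properties using (T?)
open import Data.Fin.Base using (Fin)
import Data.Fin.Properties as Fin
open import Data.List.Base using (List; []; _∷_; length; filter; reverse; allFin; cartesianProduct)
open import Data.List.Relation.Unary.Linked using (Linked)
open import Data.Nat.Base using (ℕ; suc; _+_; _*_; _≤_)
open import Data.Nat.GeneralisedArithmetic using (fold)
open import Data.Nat.Properties using (_≟_)
open import Data.Product.Base using (∃-syntax; _×_; _,_; proj₁; proj₂)
open import Data.Sum.Base using (_⊎_)
open import Function.Bundles using (_⇔_)
open import Relation.Binary.Construct.Closure.ReflexiveTransitive using (Star)
open import Relation.Binary.PropositionalEquality using (_≡_; _≢_)
open import Relation.Nullary using (¬_)
open import Relation.Nullary.Decidable using (does; _×-dec_)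

------------------------------------------------------------------------
-- Finite simple graphs

record Graph : Set where
  field
    order  : ℕ
    adj    : Fin order → Fin order → Bool
    sym    : ∀ u v → adj u v ≡ adj v u
    irrefl : ∀ v → adj v v ≡ false

  Vertex : Set
  Vertex = Fin order

  _~_ : Vertex → Vertex → Set
  u ~ v = T (adj u v)

  size : ℕ
  size = length (filter (λ e → (proj₁ e Fin.<? proj₂ e) ×-dec T? (adj (proj₁ e) (proj₂ e)))
                        (cartesianProduct (allFin order) (allFin order)))

------------------------------------------------------------------------
-- Plane embeddings, as rotation systems of genus zero

-- R is an equivalence relation with exactly k classes, numbered by `class`.
record Classes {A : Set} (R : A → A → Set) (k : ℕ) : Set where
  field
    class      : A → Fin k
    surjective : ∀ i → ∃[ x ] class x ≡ i
    related    : ∀ x y → class x ≡ class y ⇔ R x y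

-- y = fᵐ(x) for some m ≥ 0.  On a finite set permuted by f this is "x and y
-- lie on the same cycle of f".
Orbit : {A : Set} → (A → A) → A → A → Set
Orbit f x y = ∃[ m ] fold x f m ≡ y

module _ (G : Graph) where
  open Graph G

  -- `next v` is the cyclic order of the neighbours of v around v: it maps
  -- neighbours of v to neighbours of v, and they form a single cycle.  Its
  -- values on non-neighbours of v carry no meaning.
  record Rotation : Set where
    field
      next   : Vertex → Vertex → Vertex
      closed : ∀ v w → v ~ w → v ~ next v w
      cyclic : ∀ v w w′ → v ~ w → v ~ w′ → Orbit (next v) w w′

  -- The pieces of the face boundaries: the oriented edges, and for an isolated
  -- vertex, whose component has one face with no boundary edge, the vertex
  -- itself.
  data Side : Set where
    dart     : ∀ u v → .(u ~ v) → Side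
    isolated : ∀ v → .(∀ w → ¬ (v ~ w)) → Side

  origin : Side → Vertex
  origin (dart u v _)   = u
  origin (isolated v _) = v

  module _ (ρ : Rotation) where
    open Rotation ρ

    private
      flip : ∀ {u v} → u ~ v → v ~ u
      flip {u} {v} rewrite sym u v = λ p → p

    -- Face tracing: after traversing u → v, leave v along the edge that follows
    -- the edge vu in the rotation at v.
    faceStep : Side → Side
    faceStep (dart u v p)   = dart v (next v u) (closed v u (flip p))
    faceStep (isolated v p) = isolated v p

  -- The faces are the boundary walks, i.e. the cycles of `faceStep`, so each
  -- connected component has its own faces and V - E + F = 2C - 2g, where g is
  -- the sum of the genera of the components.  `euler` says that g = 0: every
  -- component is embedded in the sphere.
  record PlaneEmbedding : Set where
    field
      rotation    : Rotation
      #components : ℕ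
      components  : Classes (Star _~_) #components
      #faces      : ℕ
      faces       : Classes (Orbit (faceStep rotation)) #faces
      euler       : order + #faces ≡ size + 2 * #components

    component : Vertex → Fin #components
    component = Classes.class components

    face : Side → Fin #faces
    face = Classes.class faces

  -- In a drawing in the plane, the outer face is bounded by one boundary walk of
  -- each component; any choice of these walks, made independently in each
  -- component, is realised by a drawing.
  record OuterplaneEmbedding : Set where
    field
      embedding : PlaneEmbedding
    open PlaneEmbedding embedding public
    field
      outer     : Fin #components → Fin #faces
      onOuter   : ∀ v → ∃[ s ] origin s ≡ v × face s ≡ outer (component v)

Outerplanar : Graph → Set
Outerplanar = OuterplaneEmbedding

------------------------------------------------------------------------
-- Paths on the grid

-- (column , row).  A finite family of paths on ℕ × ℕ lies in a finite
-- rectangular grid.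
Point : Set
Point = ℕ × ℕ

data Ascends : Point → Point → Set where
  right : ∀ {x y} → Ascends (x , y) (suc x , y)
  up    : ∀ {x y} → Ascends (x , y) (x , suc y)

Joined : Point → Point → Set
Joined p q = Ascends p q ⊎ Ascends q p

record Path : Set where
  field
    points   : List Point
    nonEmpty : points ≢ []
    joined   : Linked Joined points

open Path public

-- Meant for joined points, which are horizontal neighbours iff their rows agree.
isHorizontal : Point → Point → Bool
isHorizontal p q = does (proj₂ p ≟ proj₂ q)

bendsOf : List Point → ℕ
bendsOf (p ∷ q ∷ r ∷ ps) = (if isHorizontal p q xor isHorizontal q r then 1 else 0) + bendsOf (q ∷ r ∷ ps)
bendsOf _                = 0

bends : Path → ℕ
bends P = bendsOf (points P)

Monotonic : Path → Set
Monotonic P = Linked Ascends (points P) ⊎ Linked Ascends (reverse (points P))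

data Consecutive (p q : Point) : List Point → Set where
  here  : ∀ {ps} → Consecutive p q (p ∷ q ∷ ps)
  there : ∀ {r ps} → Consecutive p q ps → Consecutive p q (r ∷ ps)

-- The grid edge between p and q, in either direction, is an edge of the path.
HasEdge : Path → Point → Point → Set
HasEdge P p q = Consecutive p q (points P) ⊎ Consecutive q p (points P)

Intersect : Path → Path → Set
Intersect P Q = ∃[ p ] ∃[ q ] HasEdge P p q × HasEdge Q p q

------------------------------------------------------------------------
-- EPG representations

record EPG (G : Graph) : Set where
  open Graph G
  field
    path     : Vertex → Path
    adjacent : ∀ u v → u ≢ v → u ~ v ⇔ Intersect (path u) (path v)

record B-EPG (k : ℕ) (G : Graph) : Set where
  field
    epg : EPG G
  open EPG epg public
  field
    fewBends : ∀ v → bends (path v) ≤ k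

record Bᵐ-EPG (k : ℕ) (G : Graph) : Set where
  field
    b-epg : B-EPG k G
  open B-EPG b-epg public
  field
    monotonic : ∀ v → Monotonic (path v)

_∈B_ : Graph → ℕ → Set
G ∈B k = B-EPG k G

_∈Bᵐ_ : Graph → ℕ → Set
G ∈Bᵐ k = Bᵐ-EPG k G

{-# OPTIONS --safe #-}

-- Fix a spanning forest of breadth-first trees.  By Euler's formula there are as many
-- edges outside it as there are faces, not counting one outer face per component; the
-- coboundary from face colourings over F₂ to these edges is injective, because a cycle
-- contained in a forest is empty, hence bijective.  This is a Jordan curve theorem: a
-- stretch of the outer walk from a to c, closed by an edge ca, separates two classes of
-- faces, so that no edge joins a vertex met between a and c to one met later.  Ordering
-- the vertices by their first visit on the outer walk therefore makes all edges
-- non-crossing.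
--
-- In such an order, a vertex has at most one neighbour on each side in the previous
-- layer of the breadth-first search, and at most one on each side in its own layer.
-- Each vertex v gets a grid line, at the coordinate given by the order, horizontal or
-- vertical by the parity of its layer.  Its path starts on the line of its left
-- parent, runs along its own line and ends on the line of its right parent.  It
-- overlaps its neighbours in its own layer on a common parent's line; if there is no
-- such parent, both have a free end and meet on a line reserved for the two.
module Submission where

open import Defs
open import Algebra.Bundles using (CommutativeMonoid; CommutativeRing)
open import Data.Bool.Base using (Bool; true; false; T; not; if_then_else_; _xor_; _∧_)
open import Data.Bool.Properties
  using (T?; ∧-comm; xor-comm; xor-assoc; xor-same; xor-identityʳ; xor-∧-commutativeRing; not-injective; not-involutive)
open import Data.Empty using (⊥; ⊥-elim; ⊥-elim-irr)
import Data.Fin.Base as Fin using (_<_)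
open import Data.Fin.Base using (Fin; zero; suc; toℕ; _↑ˡ_; _↑ʳ_; splitAt; join; punchOut; combine; funToFin; finToFun)
open import Data.Fin.Permutation using (Permutation′; permutation)
import Data.Fin.Properties as Fin
open import Data.List.Base using (List; []; _∷_; _++_; replicate; lookup; filter; allFin; cartesianProduct)
open import Data.List.Membership.Propositional using (_∈_)
open import Data.List.Membership.Propositional.Properties using (∈-filter⁺; ∈-cartesianProduct⁺; ∈-allFin)
open import Data.List.Relation.Unary.Linked as Linked using (Linked; [-]; _∷_)
import Data.List.Relation.Unary.Any as Any
import Data.List.Relation.Unary.Any.Properties as Any
open import Data.Nat.Base
open import Data.Nat.DivMod using (m<n⇒m%n≡m; [m+kn]%n≡m%n)
open import Data.Nat.GeneralisedArithmetic using (fold)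
open import Data.Nat.Properties
open import Data.Product.Base using (∃-syntax; _×_; _,_; proj₁; proj₂; uncurry)
open import Data.Sum.Base using (_⊎_; inj₁; inj₂; [_,_])
open import Function.Base using (_∘_; case_of_)
open import Function.Bundles using (_⇔_; mk⇔; Equivalence; Inverse)
open import Function.Definitions using (Injective)
open import Relation.Binary.Construct.Closure.ReflexiveTransitive using (Star; ε; _◅_)
open import Relation.Binary.Definitions using (tri<; tri≈; tri>)
open import Relation.Binary.PropositionalEquality hiding ([_])
open import Relation.Nullary using (¬_; Dec; yes; no; does; recompute; contradiction)
open import Relation.Nullary.Decidable using (_×-dec_; _⊎-dec_; map′; dec-true; dec-false)
open import Relation.Unary using (Decidable)

private
  xor-monoid = CommutativeRing.+-commutativeMonoid xor-∧-commutativeRing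

open import Algebra.Properties.CommutativeMonoid.Sum xor-monoid
  using (sum; sum-cong-≗; ∑-distrib-+; sum-permute; sum-replicate-zero)
open import Algebra.Properties.CommutativeSemigroup (CommutativeMonoid.commutativeSemigroup xor-monoid)
  using () renaming (interchange to xor-interchange)

-- Finite search and counting

Least : (ℕ → Set) → Set
Least P = ∃[ m ] P m × (∀ {k} → k < m → ¬ P k)

least : {P : ℕ → Set} → Decidable P → ∃[ m ] P m → Least P
least {P} P? (m , p) = go m 0 (λ ()) (subst P (sym (+-identityʳ m)) p)
  where
  go : ∀ fuel m → (∀ {k} → k < m → ¬ P k) → P (fuel + m) → Least P
  go fuel m none p with P? m
  ... | yes pm = m , pm , none
  go zero       m none p | no ¬pm = contradiction p ¬pm
  go (suc fuel) m none p | no ¬pm = go fuel (suc m) none′ (subst P (sym (+-suc fuel m)) p)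
    where
    none′ : ∀ {k} → k < suc m → ¬ P k
    none′ {k} (s≤s k≤m) with m≤n⇒m<n∨m≡n k≤m
    ... | inj₁ k<m  = none k<m
    ... | inj₂ refl = ¬pm

maximum : ∀ {n} → (Fin n → ℕ) → ℕ
maximum {zero}  f = 0
maximum {suc n} f = f zero ⊔ maximum (f ∘ suc)

≤-maximum : ∀ {n} (f : Fin n → ℕ) i → f i ≤ maximum f
≤-maximum f zero    = m≤m⊔n _ _
≤-maximum f (suc i) = ≤-trans (≤-maximum (f ∘ suc) i) (m≤n⊔m (f zero) _)

-- If y were missed, deleting it by `punchOut` would inject `suc n` elements into n.
injective⇒surjective : ∀ {n} {f : Fin n → Fin n} → Injective _≡_ _≡_ f → ∀ y → ∃[ x ] f x ≡ y
injective⇒surjective {suc n} {f} inj y with Fin.any? (λ x → f x Fin.≟ y)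
... | yes hit  = hit
... | no  miss = contradiction (λ {i} {j} → out-injective {i} {j}) (Fin.<⇒notInjective (n<1+n n))
  where
  missed : ∀ x → y ≢ f x
  missed x eq = miss (x , sym eq)

  out-injective : Injective _≡_ _≡_ (λ x → punchOut (missed x))
  out-injective {i} {j} eq = inj (Fin.punchOut-injective (missed i) (missed j) eq)

funToFin-cong : ∀ {m n} {f g : Fin m → Fin n} → f ≗ g → funToFin f ≡ funToFin g
funToFin-cong {zero}  f≗g = refl
funToFin-cong {suc m} f≗g = cong₂ combine (f≗g zero) (funToFin-cong (f≗g ∘ suc))

private
  fromBool : Bool → Fin 2
  fromBool b = if b then suc zero else zero

  toBool : Fin 2 → Bool
  toBool zero       = false
  toBool (suc zero) = true

  toBool-fromBool : ∀ b → toBool (fromBool b) ≡ b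
  toBool-fromBool false = refl
  toBool-fromBool true  = refl

  toBool-injective : Injective _≡_ _≡_ toBool
  toBool-injective {zero}     {zero}     _ = refl
  toBool-injective {zero}     {suc zero} ()
  toBool-injective {suc zero} {zero}     ()
  toBool-injective {suc zero} {suc zero} _ = refl

-- Counting replaces a rank argument: Boolean functions are coded by numbers below a power of two,
-- and `Φ` becomes an injective map from a finite set to itself.
injective⇒surjective-Bool : ∀ {m n} → m ≡ n → (Φ : (Fin m → Bool) → (Fin n → Bool)) →
  (∀ f g → Φ f ≗ Φ g → f ≗ g) → ∀ h → ∃[ f ] Φ f ≗ h
injective⇒surjective-Bool {m} refl Φ inj h = decode i , λ x →
  trans (sym (decode-encode (Φ (decode i)) x)) (trans (cong (λ j → decode j x) eq) (decode-encode h x))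
  where
  decode : Fin (2 ^ m) → Fin m → Bool
  decode i = toBool ∘ finToFun i

  encode : (Fin m → Bool) → Fin (2 ^ m)
  encode f = funToFin (fromBool ∘ f)

  decode-encode : ∀ f → decode (encode f) ≗ f
  decode-encode f x = trans (cong toBool (Fin.finToFun-funToFin (fromBool ∘ f) x)) (toBool-fromBool (f x))

  code-injective : Injective _≡_ _≡_ (encode ∘ Φ ∘ decode)
  code-injective {i} {j} eq = trans (sym (Fin.funToFin-finToFin {m} i)) (trans
    (funToFin-cong λ x → toBool-injective (inj (decode i) (decode j) (λ y →
      trans (sym (decode-encode (Φ (decode i)) y)) (trans (cong (λ k → decode k y) eq) (decode-encode (Φ (decode j)) y))) x))
    (Fin.funToFin-finToFin {m} j))

  pre = injective⇒surjective code-injective (encode h)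
  i   = proj₁ pre
  eq  = proj₂ pre

-- Sums over F₂

sum-zero : ∀ {n} (f : Fin n → Bool) → (∀ i → f i ≡ false) → sum f ≡ false
sum-zero {n} f f≗0 = trans (sum-cong-≗ f≗0) (sum-replicate-zero n)

sum-single : ∀ {n} (f : Fin n → Bool) i → (∀ j → j ≢ i → f j ≡ false) → sum f ≡ f i
sum-single f zero    f≗0 = trans (cong (f zero xor_) (sum-zero (f ∘ suc) (λ j → f≗0 (suc j) λ ()))) (xor-identityʳ _)
sum-single f (suc i) f≗0 = trans (cong (_xor sum (f ∘ suc)) (f≗0 zero λ ()))
  (sum-single (f ∘ suc) i λ j j≢i → f≗0 (suc j) (j≢i ∘ Fin.suc-injective))

at : ∀ {n} → Fin n → Fin n → Fin n → Fin n → Bool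
at a b u v = does (u Fin.≟ a) ∧ does (v Fin.≟ b)

sum-at : ∀ {n} (a b u : Fin n) → sum (at a b u) ≡ does (u Fin.≟ a)
sum-at {n} a b u with u Fin.≟ a
... | no _  = sum-zero {n} (λ _ → false) λ _ → refl
... | yes _ = trans (sum-single (λ v → does (v Fin.≟ b)) b (λ j j≢b → dec-false (j Fin.≟ b) j≢b)) (dec-true (b Fin.≟ b) refl)

xor-≡ : ∀ {x y} → x xor y ≡ false → x ≡ y
xor-≡ {false} {false} _ = refl
xor-≡ {true}  {true}  _ = refl

≡-xor : ∀ {x y} → x ≡ y → x xor y ≡ false
≡-xor {x} refl = xor-same x

-- Any choice of preimages is injective, hence onto by counting, and therefore a two-sided inverse.
surjective⇒permutation : ∀ {n} (f : Fin n → Fin n) → (∀ y → ∃[ x ] f x ≡ y) → Permutation′ n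
surjective⇒permutation f surj = permutation f g (proj₂ ∘ surj) λ x →
  let y , gy≡x = injective⇒surjective g-injective x
  in trans (cong g (trans (cong f (sym gy≡x)) (proj₂ (surj y)))) gy≡x
  where
  g = proj₁ ∘ surj
  g-injective : ∀ {x y} → g x ≡ g y → x ≡ y
  g-injective {x} {y} eq = trans (sym (proj₂ (surj x))) (trans (cong f eq) (proj₂ (surj y)))

-- Breadth-first layers and the spanning forest

module GraphProperties (G : Graph) where
  open Graph G renaming (sym to adj-sym)

  ~-sym : ∀ {u v} → u ~ v → v ~ u
  ~-sym {u} {v} = subst T (adj-sym u v)

  ~⇒≢ : ∀ {u v} → u ~ v → u ≢ v
  ~⇒≢ {u} p refl = subst T (irrefl u) p

module Layers (G : Graph) {k : ℕ} (components : Classes (Star (Graph._~_ G)) k) where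
  open Graph G using (adj; _~_; Vertex)
  open GraphProperties G
  open Classes components renaming (class to component)

  ~⇒component : ∀ {u v} → u ~ v → component u ≡ component v
  ~⇒component {u} {v} p = Equivalence.from (related u v) (p ◅ ε)

  representative : Fin k → Vertex
  representative i = proj₁ (surjective i)

  root : Vertex → Vertex
  root v = representative (component v)

  -- Distance at most m from the root. The recursive case refers to the root of w, which is also
  -- that of v because adjacent vertices share a component.
  Within : ℕ → Vertex → Set
  Within zero    v = v ≡ root v
  Within (suc m) v = Within m v ⊎ ∃[ w ] v ~ w × Within m w

  within? : ∀ m v → Dec (Within m v)
  within? zero    v = v Fin.≟ root v
  within? (suc m) v = within? m v ⊎-dec Fin.any? (λ w → T? (adj v w) ×-dec within? m w)

  reach : ∀ {v r} → r ≡ root v → Star _~_ v r → ∃[ m ] Within m v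
  reach eq ε         = 0 , eq
  reach eq (e ◅ es) with reach (trans eq (cong representative (~⇒component e))) es
  ... | m , p = suc m , inj₂ (_ , e , p)

  layerOf : ∀ v → Least (λ m → Within m v)
  layerOf v = least (λ m → within? m v)
    (reach refl (Equivalence.to (related v (root v)) (sym (proj₂ (surjective (component v))))))

  layer : Vertex → ℕ
  layer v = proj₁ (layerOf v)

  layer-≤ : ∀ {m v} → Within m v → layer v ≤ m
  layer-≤ {m} {v} p with layer v ≤? m
  ... | yes le = le
  ... | no ¬le = contradiction p (proj₂ (proj₂ (layerOf v)) (≰⇒> ¬le))

  layer-step : ∀ {u v} → u ~ v → layer u ≤ suc (layer v)
  layer-step {v = v} p = layer-≤ (inj₂ (v , p , proj₁ (proj₂ (layerOf v))))

  layer-zero : ∀ {v} → layer v ≡ 0 → v ≡ root v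
  layer-zero {v} eq = subst (λ m → Within m v) eq (proj₁ (proj₂ (layerOf v)))

  layer-suc : ∀ v → layer v ≡ 0 ⊎ ∃[ w ] v ~ w × layer v ≡ suc (layer w)
  layer-suc v with layerOf v in eq
  ... | zero  , _ , _ = inj₁ refl
  ... | suc m , inj₁ p , below = contradiction p (below ≤-refl)
  ... | suc m , inj₂ (w , e , p) , _ = inj₂ (w , e , cong suc (≤-antisym
          (s≤s⁻¹ (subst (_≤ suc (layer w)) (cong proj₁ eq) (layer-step e))) (layer-≤ p)))

  parent : Vertex → Vertex
  parent v with layer-suc v
  -- A default for roots; it creates no `Child`, since a child has a positive layer.
  ... | inj₁ _       = v
  ... | inj₂ (w , _) = w

  Child : Vertex → Vertex → Set
  Child u v = u ~ v × layer u ≡ suc (layer v) × v ≡ parent u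

  child? : ∀ u v → Dec (Child u v)
  child? u v = T? (adj u v) ×-dec (layer u ≟ suc (layer v)) ×-dec (v Fin.≟ parent u)

  child-parent : ∀ v → layer v ≡ 0 ⊎ Child v (parent v)
  child-parent v with layer-suc v
  ... | inj₁ z            = inj₁ z
  ... | inj₂ (w , e , eq) = inj₂ (e , eq , refl)

  child-asym : ∀ {u v} → Child u v → ¬ Child v u
  child-asym (_ , eq , _) (_ , eq′ , _) = 1+n≰n (≤-trans (≤-trans (n≤1+n _) (≤-reflexive (sym (cong suc eq)))) (≤-reflexive (sym eq′)))

  -- A cycle over F₂ supported on a forest is empty. Working up from the deepest layer, the edges
  -- from u to its children already carry `false`, so evenness at u forces `false` on the edge to
  -- its parent.
  forest-acyclic : (e : Vertex → Vertex → Bool) → (∀ u v → e u v ≡ e v u) →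
    (∀ u v → ¬ Child u v → ¬ Child v u → e u v ≡ false) → (∀ v → sum (e v) ≡ false) → ∀ u v → e u v ≡ false
  forest-acyclic e e-sym off even = vanish
    where
    -- The fuel exceeds the number of layers beyond that of u, which bounds the recursion into the
    -- children of u.
    climb : ∀ fuel {u v} → Child u v → maximum layer < layer u + fuel → e u v ≡ false
    climb zero       {u}     c lt = contradiction (≤-maximum layer u) (<⇒≱ (subst (maximum layer <_) (+-identityʳ _) lt))
    climb (suc fuel) {u} {v} c lt = trans (sym (sum-single (e u) v others)) (even u)
      where
      others : ∀ w → w ≢ v → e u w ≡ false
      others w w≢v with child? u w | child? w u
      ... | yes (_ , _ , eq) | _      = contradiction (trans eq (sym (proj₂ (proj₂ c)))) w≢v
      ... | no _             | yes c′ = trans (e-sym u w) (climb fuel c′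
              (subst (maximum layer <_) (trans (+-suc (layer u) fuel) (cong (_+ fuel) (sym (proj₁ (proj₂ c′))))) lt))
      ... | no ¬c₁           | no ¬c₂ = off u w ¬c₁ ¬c₂

    vanish : ∀ u v → e u v ≡ false
    vanish u v with child? u v | child? v u
    ... | yes c  | _      = climb (suc (maximum layer)) c (m≤n+m _ _)
    ... | no _   | yes c  = trans (e-sym u v) (climb (suc (maximum layer)) c (m≤n+m _ _))
    ... | no ¬c₁ | no ¬c₂ = off u v ¬c₁ ¬c₂

-- Rotations and face tracing

module Darts (G : Graph) (ρ : Rotation G) where
  open Graph G using (order; adj; _~_; Vertex)
  open GraphProperties G
  open Rotation ρ

  -- `next v` says nothing about non-neighbours; fixing them makes it a permutation of all vertices,
  -- under which sums can be reindexed.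
  turn : Vertex → Vertex → Vertex
  turn v w with T? (adj v w)
  ... | yes _ = next v w
  ... | no _  = w

  turn-~ : ∀ {v w} → v ~ w → turn v w ≡ next v w
  turn-~ {v} {w} p with T? (adj v w)
  ... | yes _ = refl
  ... | no ¬p = contradiction p ¬p

  turn-≁ : ∀ {v w} → ¬ v ~ w → turn v w ≡ w
  turn-≁ {v} {w} ¬p with T? (adj v w)
  ... | yes p = contradiction p ¬p
  ... | no _  = refl

  fold-~ : ∀ {v w} → v ~ w → ∀ m → v ~ fold w (next v) m
  fold-~ p zero    = p
  fold-~ p (suc m) = closed _ _ (fold-~ p m)

  turn-surjective : ∀ v y → ∃[ x ] turn v x ≡ y
  turn-surjective v y with T? (adj v y)
  ... | no ¬p = y , turn-≁ ¬p
  ... | yes p with cyclic v (next v y) y (closed v y p) p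
  ...   | zero  , eq = y , trans (turn-~ p) eq
  ...   | suc m , eq = fold (next v y) (next v) m , trans (turn-~ (fold-~ (closed v y p) m)) eq

  turning : Vertex → Permutation′ order
  turning v = surjective⇒permutation (turn v) (turn-surjective v)

  turn-injective : ∀ v {w w′} → turn v w ≡ turn v w′ → w ≡ w′
  turn-injective v {w} {w′} eq = trans (sym (Inv.strictlyInverseʳ w)) (trans (cong Inv.from eq) (Inv.strictlyInverseʳ w′))
    where
    module Inv = Inverse (turning v)

  next-invariant : ∀ {v} (c : Vertex → Bool) → (∀ {w} → v ~ w → c (next v w) ≡ c w) →
    ∀ {w w′} → v ~ w → v ~ w′ → c w ≡ c w′
  next-invariant {v} c step {w} {w′} p p′ with cyclic v w w′ p p′
  ... | m , refl = sym (go m)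
    where
    go : ∀ m → c (fold w (next v) m) ≡ c w
    go zero    = refl
    go (suc m) = trans (step (fold-~ p m)) (go m)

  -- Extension by `false` to pairs that are not darts, so that sums range over all vertices.
  onDarts : (Side G → Bool) → Vertex → Vertex → Bool
  onDarts g u v with T? (adj u v)
  ... | yes p = g (dart u v p)
  ... | no _  = false

  onDarts-~ : ∀ g {u v} (p : u ~ v) → onDarts g u v ≡ g (dart u v p)
  onDarts-~ g {u} {v} p with T? (adj u v)
  ... | yes _ = refl
  ... | no ¬p = contradiction p ¬p

  onDarts-≁ : ∀ g {u v} → ¬ u ~ v → onDarts g u v ≡ false
  onDarts-≁ g {u} {v} ¬p with T? (adj u v)
  ... | yes p = contradiction p ¬p
  ... | no _  = refl

  -- Every dart out of v follows a dart into v across one corner, so permuting the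
  -- sum by the rotation trades jumps of g across edges for jumps across corners.
  sum-around : ∀ g (j : Vertex → Vertex → Bool) →
    (∀ {v w} (p : w ~ v) → g (faceStep G ρ (dart w v p)) xor g (dart w v p) ≡ j v (next v w)) →
    (∀ {v w} → ¬ v ~ w → j v w ≡ false) →
    ∀ v → sum (λ w → onDarts g v w xor onDarts g w v) ≡ sum (j v)
  sum-around g j corner off v = begin
    sum (λ w → κ v w xor κ w v)                 ≡⟨ ∑-distrib-+ (κ v) (λ w → κ w v) ⟩
    sum (κ v) xor sum (λ w → κ w v)             ≡⟨ cong (_xor sum (λ w → κ w v)) (sum-permute (κ v) (turning v)) ⟩
    sum (κ v ∘ turn v) xor sum (λ w → κ w v)    ≡⟨ ∑-distrib-+ (κ v ∘ turn v) (λ w → κ w v) ⟨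
    sum (λ w → κ v (turn v w) xor κ w v)        ≡⟨ sum-cong-≗ local ⟩
    sum (j v ∘ turn v)                          ≡⟨ sum-permute (j v) (turning v) ⟨
    sum (j v)                                   ∎
    where
    open ≡-Reasoning
    κ = onDarts g
    local : ∀ w → κ v (turn v w) xor κ w v ≡ j v (turn v w)
    local w with T? (adj v w)
    ... | yes p = trans (cong₂ _xor_ (onDarts-~ g (closed v w p)) (onDarts-~ g (~-sym p))) (corner (~-sym p))
    ... | no ¬p = trans (cong₂ _xor_ (onDarts-≁ g ¬p) (onDarts-≁ g (¬p ∘ ~-sym))) (sym (off ¬p))

-- Face colourings

module Jordan (G : Graph) (O : OuterplaneEmbedding G) where
  open Graph G using (order; adj; _~_; Vertex; size)
  open GraphProperties G
  open OuterplaneEmbedding O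
  open Layers G components using (representative; Child; child?; child-parent; child-asym; forest-acyclic; layer-zero)
  open Darts G rotation
  open Classes faces using () renaming (surjective to face-surjective; related to face-related)

  face-step : ∀ s → face (faceStep G rotation s) ≡ face s
  face-step s = sym (Equivalence.from (face-related s _) (1 , refl))

  -- The coboundary over F₂ of a colouring of the faces: an edge is marked when the faces along its
  -- two darts have different colours.
  δ : (Fin #faces → Bool) → Vertex → Vertex → Bool
  δ χ u v = onDarts (χ ∘ face) u v xor onDarts (χ ∘ face) v u

  δ-cong : ∀ {χ χ′} → χ ≗ χ′ → ∀ {u v} → u ~ v → δ χ u v ≡ δ χ′ u v
  δ-cong {χ} {χ′} χ≗χ′ p = cong₂ _xor_ (colour p) (colour (~-sym p))
    where
    colour : ∀ {u v} → u ~ v → onDarts (χ ∘ face) u v ≡ onDarts (χ′ ∘ face) u v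
    colour p = trans (onDarts-~ (χ ∘ face) p) (trans (χ≗χ′ _) (sym (onDarts-~ (χ′ ∘ face) p)))

  δ-xor : ∀ χ χ′ {u v} → u ~ v → δ (λ f → χ f xor χ′ f) u v ≡ δ χ u v xor δ χ′ u v
  δ-xor χ χ′ {u} {v} p = trans (cong₂ _xor_ (colour p) (colour (~-sym p)))
    (xor-interchange (onDarts (χ ∘ face) u v) (onDarts (χ′ ∘ face) u v) (onDarts (χ ∘ face) v u) (onDarts (χ′ ∘ face) v u))
    where
    colour : ∀ {u v} → u ~ v → onDarts (λ s → χ (face s) xor χ′ (face s)) u v ≡ onDarts (χ ∘ face) u v xor onDarts (χ′ ∘ face) u v
    colour p = trans (onDarts-~ (λ s → χ (face s) xor χ′ (face s)) p)
      (sym (cong₂ _xor_ (onDarts-~ (χ ∘ face) p) (onDarts-~ (χ′ ∘ face) p)))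

  module _ (χ : Fin #faces → Bool)
           (flat-off-tree : ∀ {u v} → u ~ v → ¬ Child u v → ¬ Child v u → δ χ u v ≡ false) where

    -- The face does not change at a corner, so the marked edges have even degree at each vertex; by
    -- assumption they lie in the forest.
    flat : ∀ u v → δ χ u v ≡ false
    flat = forest-acyclic (δ χ) (λ u v → xor-comm (onDarts (χ ∘ face) u v) (onDarts (χ ∘ face) v u)) off
      λ v → trans (sum-around (χ ∘ face) (λ _ _ → false) (λ {v} {w} p → ≡-xor (cong χ (face-step (dart w v p)))) (λ _ → refl) v)
                  (sum-zero {order} (λ _ → false) (λ _ → refl))
      where
      off : ∀ u v → ¬ Child u v → ¬ Child v u → δ χ u v ≡ false
      off u v ¬c ¬c′ = case T? (adj u v) of λ where
        (yes p) → flat-off-tree p ¬c ¬c′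
        (no ¬p) → cong₂ _xor_ (onDarts-≁ (χ ∘ face) ¬p) (onDarts-≁ (χ ∘ face) (¬p ∘ ~-sym))

    -- Around a vertex the colour changes neither at a corner, which stays within one face, nor
    -- across an edge, by `flat`.
    same-origin : ∀ s s′ → origin G s ≡ origin G s′ → χ (face s) ≡ χ (face s′)
    same-origin (dart u v p) (dart .u v′ p′) refl =
      trans (sym (onDarts-~ (χ ∘ face) u~v)) (trans (next-invariant (onDarts (χ ∘ face) u) step u~v u~v′) (onDarts-~ (χ ∘ face) u~v′))
      where
      u~v = recompute (T? (adj u v)) p
      u~v′ = recompute (T? (adj u v′)) p′
      step : ∀ {w} → u ~ w → onDarts (χ ∘ face) u (Rotation.next rotation u w) ≡ onDarts (χ ∘ face) u w
      step {w} q = trans (onDarts-~ (χ ∘ face) (Rotation.closed rotation u w q))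
        (trans (cong χ (face-step (dart w u (~-sym q)))) (trans (sym (onDarts-~ (χ ∘ face) (~-sym q))) (xor-≡ (flat w u))))
    same-origin (dart u v p)    (isolated .u q) refl = ⊥-elim-irr (q v p)
    same-origin (isolated .u q) (dart u v p)    refl = ⊥-elim-irr (q v p)
    same-origin (isolated v _)  (isolated .v _) refl = refl

    -- Here outerplanarity enters: each face touches some vertex, and that vertex also touches the
    -- outer face of its component.
    flat⇒zero : (∀ i → χ (outer i) ≡ false) → ∀ f → χ f ≡ false
    flat⇒zero zero-outer f with face-surjective f
    ... | s , refl with onOuter (origin G s)
    ...   | s′ , eq , on = trans (same-origin s s′ (sym eq)) (trans (cong χ on) (zero-outer _))

  -- A square linear system from Euler's formula

  private
    edges : List (Vertex × Vertex)
    edges = filter (λ e → (proj₁ e Fin.<? proj₂ e) ×-dec T? (adj (proj₁ e) (proj₂ e)))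
                   (cartesianProduct (allFin order) (allFin order))

    onEdges : {f g : Vertex → Vertex → Bool} → (∀ u v → f u v ≡ f v u) → (∀ u v → g u v ≡ g v u) →
      (∀ i → uncurry f (lookup edges i) ≡ uncurry g (lookup edges i)) → ∀ {u v} → u ~ v → f u v ≡ g u v
    onEdges {f} {g} f-sym g-sym eq {u} {v} p = [ listed p , (λ v<u → trans (f-sym u v) (trans (listed (~-sym p) v<u) (g-sym v u))) ] (≢⇒<⊎> (~⇒≢ p))
      where
      ≢⇒<⊎> : ∀ {u v : Vertex} → u ≢ v → u Fin.< v ⊎ v Fin.< u
      ≢⇒<⊎> {u} {v} u≢v with Fin.<-cmp u v
      ... | tri< u<v _ _ = inj₁ u<v
      ... | tri≈ _ u≡v _ = contradiction u≡v u≢v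
      ... | tri> _ _ v<u = inj₂ v<u

      listed : ∀ {u v} → u ~ v → u Fin.< v → f u v ≡ g u v
      listed {u} {v} p u<v = subst (λ e → uncurry f e ≡ uncurry g e) (sym (Any.lookup-index u,v∈)) (eq (Any.index u,v∈))
        where
        u,v∈ : (u , v) ∈ edges
        u,v∈ = ∈-filter⁺ _ (∈-cartesianProduct⁺ (∈-allFin u) (∈-allFin v)) (u<v , p)

    branch : (Vertex → Bool) → Vertex → Vertex → Bool
    branch t u v = does (child? u v) ∧ t u

    -- On a forest edge the unknown `t` of the child can absorb any prescribed value, so only the
    -- edges off the forest constrain `χ`. Together the unknowns number `order + #faces`, one side
    -- of Euler's formula.
    onEdge : (Vertex → Bool) → (Fin #faces → Bool) → Vertex → Vertex → Bool
    onEdge t χ u v = δ χ u v xor (branch t u v xor branch t v u)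

    onEdge-sym : ∀ t χ u v → onEdge t χ u v ≡ onEdge t χ v u
    onEdge-sym t χ u v = cong₂ _xor_ (xor-comm (onDarts (χ ∘ face) u v) (onDarts (χ ∘ face) v u)) (xor-comm (branch t u v) (branch t v u))

    onEdge-off-tree : ∀ t χ {u v} → ¬ Child u v → ¬ Child v u → onEdge t χ u v ≡ δ χ u v
    onEdge-off-tree t χ {u} {v} ¬c ¬c′ rewrite dec-false (child? u v) ¬c | dec-false (child? v u) ¬c′ = xor-identityʳ _

    onEdge-tree : ∀ t χ {u v} → Child u v → onEdge t χ u v ≡ δ χ u v xor t u
    onEdge-tree t χ {u} {v} c rewrite dec-true (child? u v) c | dec-false (child? v u) (child-asym c) = cong (δ χ u v xor_) (xor-identityʳ (t u))

    onVertices : (Fin (order + #faces) → Bool) → Vertex → Bool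
    onVertices x v = x (v ↑ˡ #faces)

    onFaces : (Fin (order + #faces) → Bool) → Fin #faces → Bool
    onFaces x f = x (order ↑ʳ f)

    -- Equations are numbered as on the other side of Euler's formula: the edges, then the
    -- components twice. `2 * #components` unfolds with a trailing `+ 0`, hence the absurd last
    -- case.
    tagged : (Fin size → Bool) → (Fin #components → Bool) → (Fin #components → Bool) → Fin (size + 2 * #components) → Bool
    tagged e c c′ i = [ e , [ c , [ c′ , (λ ()) ] ∘ splitAt #components ] ∘ splitAt #components ] (splitAt size i)

    tagged-edge : ∀ e c c′ i → tagged e c c′ (i ↑ˡ (2 * #components)) ≡ e i
    tagged-edge e c c′ i rewrite Fin.splitAt-↑ˡ size i (2 * #components) = refl

    tagged-first : ∀ e c c′ i → tagged e c c′ (size ↑ʳ (i ↑ˡ (#components + 0))) ≡ c i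
    tagged-first e c c′ i rewrite Fin.splitAt-↑ʳ size (2 * #components) (i ↑ˡ (#components + 0))
      | Fin.splitAt-↑ˡ #components i (#components + 0) = refl

    tagged-second : ∀ e c c′ i → tagged e c c′ (size ↑ʳ (#components ↑ʳ (i ↑ˡ 0))) ≡ c′ i
    tagged-second e c c′ i rewrite Fin.splitAt-↑ʳ size (2 * #components) (#components ↑ʳ (i ↑ˡ 0))
      | Fin.splitAt-↑ʳ #components (#components + 0) (i ↑ˡ 0) | Fin.splitAt-↑ˡ #components i 0 = refl

    module _ {e e′ c c′ d d′} (eq : tagged e c d ≗ tagged e′ c′ d′) where
      tagged-edge-≗ : e ≗ e′
      tagged-edge-≗ i = trans (sym (tagged-edge e c d i)) (trans (eq _) (tagged-edge e′ c′ d′ i))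

      tagged-first-≗ : c ≗ c′
      tagged-first-≗ i = trans (sym (tagged-first e c d i)) (trans (eq _) (tagged-first e′ c′ d′ i))

      tagged-second-≗ : d ≗ d′
      tagged-second-≗ i = trans (sym (tagged-second e c d i)) (trans (eq _) (tagged-second e′ c′ d′ i))

    edgePart : (Fin (order + #faces) → Bool) → Fin size → Bool
    edgePart x = uncurry (onEdge (onVertices x) (onFaces x)) ∘ lookup edges

    -- Besides one equation per edge, two families fix `t` at the roots and the colours of the outer
    -- faces.
    Φ : (Fin (order + #faces) → Bool) → Fin (size + 2 * #components) → Bool
    Φ x = tagged (edgePart x) (onVertices x ∘ representative) (onFaces x ∘ outer)

    -- The edges off the forest make the difference of the two colourings flat, so it vanishes by
    -- `flat⇒zero`. Then the forest edges determine `t` at every vertex but the roots, where it is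
    -- fixed directly.
    Φ-injective : ∀ x y → Φ x ≗ Φ y → x ≗ y
    Φ-injective x y eq i = trans (cong x (sym (Fin.join-splitAt order #faces i)))
      (trans (split (splitAt order i)) (cong y (Fin.join-splitAt order #faces i)))
      where
      tx = onVertices x
      ty = onVertices y
      χx = onFaces x
      χy = onFaces y

      edge-eq : ∀ {u v} → u ~ v → onEdge tx χx u v ≡ onEdge ty χy u v
      edge-eq = onEdges (onEdge-sym tx χx) (onEdge-sym ty χy) (tagged-edge-≗ {edgePart x} {edgePart y} eq)

      face-eq : χx ≗ χy
      face-eq f = xor-≡ (flat⇒zero (λ f → χx f xor χy f)
        (λ {u} {v} p ¬c ¬c′ → trans (δ-xor χx χy p) (≡-xor (trans (sym (onEdge-off-tree tx χx ¬c ¬c′))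
          (trans (edge-eq p) (onEdge-off-tree ty χy ¬c ¬c′)))))
        (λ i → ≡-xor (tagged-second-≗ {edgePart x} {edgePart y} eq i)) f)

      xor-cancelˡ : ∀ a {b c} → a xor b ≡ a xor c → b ≡ c
      xor-cancelˡ false eq = eq
      xor-cancelˡ true {false} {false} eq = refl
      xor-cancelˡ true {true}  {true}  eq = refl

      vertex-eq : tx ≗ ty
      vertex-eq v with child-parent v
      ... | inj₁ z = trans (cong tx (layer-zero z))
              (trans (tagged-first-≗ {edgePart x} {edgePart y} eq (component v)) (cong ty (sym (layer-zero z))))
      ... | inj₂ c = xor-cancelˡ (δ χx v _) (trans (sym (onEdge-tree tx χx c)) (trans (edge-eq (proj₁ c))
              (trans (onEdge-tree ty χy c) (cong (_xor ty v) (sym (δ-cong face-eq (proj₁ c)))))))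

      split : ∀ s → x (join order #faces s) ≡ y (join order #faces s)
      split (inj₁ v) = vertex-eq v
      split (inj₂ f) = face-eq f

  -- A spanning forest has order ∸ #components edges, so by Euler's formula there
  -- are as many edges outside the forest as faces other than the chosen outer ones.
  solve-off-tree : (z : Vertex → Vertex → Bool) → (∀ u v → z u v ≡ z v u) →
    ∃[ χ ] (∀ {u v} → u ~ v → ¬ Child u v → ¬ Child v u → δ χ u v ≡ z u v)
  solve-off-tree z z-sym = onFaces x , λ p ¬c ¬c′ → trans (sym (onEdge-off-tree (onVertices x) (onFaces x) ¬c ¬c′))
    (onEdges (onEdge-sym (onVertices x) (onFaces x)) z-sym (tagged-edge-≗ {edgePart x} {z-edges} x-solves) p)
    where
    z-edges : Fin size → Bool
    z-edges = uncurry z ∘ lookup edges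

    solution = injective⇒surjective-Bool euler Φ Φ-injective (tagged z-edges (λ _ → false) (λ _ → false))
    x = proj₁ solution

    x-solves : Φ x ≗ tagged z-edges (λ _ → false) (λ _ → false)
    x-solves = proj₂ solution

-- The outer walk

-- Read B and A as lying in a set before and after a step, C as entering it and D as leaving it.
does-jump : ∀ {A B C D : Set} (A? : Dec A) (B? : Dec B) (C? : Dec C) (D? : Dec D) →
  (C → A × ¬ B) → (D → ¬ A × B) → (A → B ⊎ C) → (B → A ⊎ D) →
  does A? xor does B? ≡ does C? xor does D?
does-jump (yes a) (yes b) (yes c) _       f g h k = contradiction b (proj₂ (f c))
does-jump (yes a) (yes b) (no _)  (yes d) f g h k = contradiction a (proj₁ (g d))
does-jump (yes a) (yes b) (no _)  (no _)  f g h k = refl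
does-jump (yes a) (no ¬b) (yes c) (yes d) f g h k = contradiction a (proj₁ (g d))
does-jump (yes a) (no ¬b) (yes c) (no _)  f g h k = refl
does-jump (yes a) (no ¬b) (no ¬c) _       f g h k = contradiction (h a) [ ¬b , ¬c ]
does-jump (no ¬a) _       (yes c) _       f g h k = contradiction (proj₁ (f c)) ¬a
does-jump (no ¬a) (yes b) (no _)  (yes d) f g h k = refl
does-jump (no ¬a) (yes b) (no _)  (no ¬d) f g h k = contradiction (k b) [ ¬a , ¬d ]
does-jump (no ¬a) (no ¬b) (no _)  (yes d) f g h k = contradiction (proj₂ (g d)) ¬b
does-jump (no ¬a) (no ¬b) (no _)  (no _)  f g h k = refl

module OuterWalk (G : Graph) (O : OuterplaneEmbedding G) where
  open Graph G using (order; adj; _~_; Vertex)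
  open GraphProperties G
  open OuterplaneEmbedding O
  open Layers G components using (representative; Child; forest-acyclic)
  open Darts G rotation
  open Jordan G O
  open Rotation rotation

  step : Side G → Side G
  step = faceStep G rotation

  target : Side G → Vertex
  target (dart _ v _)   = v
  target (isolated v _) = v

  ends-injective : ∀ s s′ → origin G s ≡ origin G s′ → target s ≡ target s′ → s ≡ s′
  ends-injective (dart u v p)   (dart .u .v p′)  refl refl = refl
  ends-injective (dart u .u p)  (isolated .u _)  refl refl = ⊥-elim-irr (~⇒≢ p refl)
  ends-injective (isolated u _) (dart .u .u p)   refl refl = ⊥-elim-irr (~⇒≢ p refl)
  ends-injective (isolated u _) (isolated .u _)  refl refl = refl

  _≟ˢ_ : (s s′ : Side G) → Dec (s ≡ s′)
  s ≟ˢ s′ = map′ (uncurry (ends-injective s s′)) (λ eq → cong (origin G) eq , cong target eq)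
    ((origin G s Fin.≟ origin G s′) ×-dec (target s Fin.≟ target s′))

  -- A dart and its successor share a vertex, and the rotation there is injective.
  step-injective : ∀ s s′ → step s ≡ step s′ → s ≡ s′
  step-injective (dart u v p) (dart u′ v′ p′) eq with cong (origin G) eq
  ... | refl with turn-injective v (trans (turn-~ (~-sym (recompute (T? (adj u v)) p)))
                    (trans (cong target eq) (sym (turn-~ (~-sym (recompute (T? (adj u′ v)) p′))))))
  ...   | refl = refl
  step-injective (dart _ _ _)   (isolated _ _) ()
  step-injective (isolated _ _) (dart _ _ _)   ()
  step-injective (isolated _ _) (isolated _ _) eq = eq

  -- The walk starts at the root of the component, so that the root comes first in the order;
  -- `root-uncovered` depends on this.
  walk : Fin #components → ℕ → Side G
  walk k = fold (proj₁ (onOuter (representative k))) step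

  walk-face : ∀ k m → face (walk k m) ≡ outer k
  walk-face k zero    = trans (proj₂ (proj₂ (onOuter (representative k)))) (cong outer (proj₂ (Classes.surjective components k)))
  walk-face k (suc m) = trans (face-step (walk k m)) (walk-face k m)

  FirstVisit : Fin #components → Vertex → ℕ → Set
  FirstVisit k v m = origin G (walk k m) ≡ v × (∀ {j} → j < m → ¬ origin G (walk k j) ≡ v)

  visit : ∀ v → Least (λ m → origin G (walk (component v) m) ≡ v)
  visit v = least (λ m → origin G (walk (component v) m) Fin.≟ v)
    (let s , eq , on = onOuter v
         m , eq′ = Equivalence.to (Classes.related faces _ s) (trans (walk-face (component v) 0) (sym on))
     in m , trans (cong (origin G) eq′) eq)

  shift : ∀ k {m m′} j → walk k m ≡ walk k m′ → walk k (j + m) ≡ walk k (j + m′)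
  shift k zero    eq = eq
  shift k (suc j) eq = cong step (shift k j eq)

  -- A repetition makes the walk periodic, so no vertex is first seen after it.
  distinct : ∀ {k v i} → FirstVisit k v i → ∀ {m m′} → m < m′ → m′ ≤ i → walk k m ≢ walk k m′
  distinct {k} {v} {i} (visits , first) {m} {m′} m<m′ m′≤i eq = first {i ∸ m′ + m}
    (subst (i ∸ m′ + m <_) (m∸n+n≡m m′≤i) (+-monoʳ-< (i ∸ m′) m<m′))
    (trans (cong (origin G) (trans (shift k (i ∸ m′) eq) (cong (walk k) (m∸n+n≡m m′≤i)))) visits)

  dart-from : ∀ {u v} → u ~ v → ∀ s → origin G s ≡ u → origin G s ~ target s
  dart-from p (dart u v q)   refl = recompute (T? (adj u v)) q
  dart-from {v = v} p (isolated u q) refl = ⊥-elim-irr (q v p)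

  at-≁ : ∀ {a b} → a ~ b → ∀ {u v} → ¬ u ~ v → at a b u v ≡ false
  at-≁ {a} {b} p {u} {v} ¬q with u Fin.≟ a | v Fin.≟ b
  ... | no _     | _        = refl
  ... | yes _    | no _     = refl
  ... | yes refl | yes refl = contradiction p ¬q

  at-≢ : ∀ {a : Vertex} b {u} → u ≢ a → ∀ v → at a b u v ≡ false
  at-≢ {a} b {u} u≢a v with u Fin.≟ a
  ... | no _    = refl
  ... | yes u≡a = contradiction u≡a u≢a

  -- Closing the stretch of the outer walk from a to c by the edge ca gives a
  -- cycle; colour the two sides of it.
  module Chord {k a c i l} (a~c : a ~ c) (visit-a : FirstVisit k a i) (visit-c : FirstVisit k c l) (i<l : i < l) where

    Inside : Side G → Set
    Inside s = ∃[ m ] m < l × i ≤ m × walk k m ≡ s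

    inside? : ∀ s → Dec (Inside s)
    inside? s = anyUpTo? (λ m → (i ≤? m) ×-dec (walk k m ≟ˢ s)) l

    inside : Side G → Bool
    inside s = does (inside? s)

    -- The corners where `inside` changes, named by their outgoing darts: the stretch is entered at
    -- a by `walk k i`, and `walk k l` out of c is the first dart beyond it.
    corner : Vertex → Vertex → Bool
    corner u v = at (origin G (walk k i)) (target (walk k i)) u v xor at (origin G (walk k l)) (target (walk k l)) u v

    -- Up to time l no side repeats, because c is first seen then. Together with the injectivity of
    -- `step`, this leaves only one way into the stretch and one way out.
    inside-step : ∀ s → inside (step s) xor inside s ≡ does (step s ≟ˢ walk k i) xor does (step s ≟ˢ walk k l)
    inside-step s = does-jump (inside? (step s)) (inside? s) (step s ≟ˢ walk k i) (step s ≟ˢ walk k l) enter leave entering leaving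
      where
      enter : step s ≡ walk k i → Inside (step s) × ¬ Inside s
      enter eq = (i , i<l , ≤-refl , sym eq) , λ where
        (m , m<l , i≤m , refl) → distinct visit-c (s≤s i≤m) m<l (sym eq)

      predecessor : ∀ {m} → walk k m ≡ step s → i < m → m ≤ l → Inside s
      predecessor {suc m} eq i<m m≤l = m , m≤l , s≤s⁻¹ i<m , step-injective _ _ eq

      leave : step s ≡ walk k l → ¬ Inside (step s) × Inside s
      leave eq = (λ where (m , m<l , _ , eq′) → distinct visit-c m<l ≤-refl (trans eq′ eq)) ,
                 predecessor (sym eq) i<l ≤-refl

      entering : Inside (step s) → Inside s ⊎ step s ≡ walk k i
      entering (m , m<l , i≤m , eq) with m≤n⇒m<n∨m≡n i≤m
      ... | inj₁ i<m  = inj₁ (predecessor eq i<m (<⇒≤ m<l))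
      ... | inj₂ refl = inj₂ (sym eq)

      leaving : Inside s → Inside (step s) ⊎ step s ≡ walk k l
      leaving (m , m<l , i≤m , refl) with m≤n⇒m<n∨m≡n m<l
      ... | inj₁ 1+m<l = inj₁ (suc m , 1+m<l , m≤n⇒m≤1+n i≤m , refl)
      ... | inj₂ refl  = inj₂ refl

    edge : Vertex → Vertex → Bool
    edge u v = at a c u v xor at c a u v

    edge-sym : ∀ u v → edge u v ≡ edge v u
    edge-sym u v = trans (xor-comm (at a c u v) (at c a u v))
      (cong₂ _xor_ (∧-comm (does (u Fin.≟ c)) (does (v Fin.≟ a))) (∧-comm (does (u Fin.≟ a)) (does (v Fin.≟ c))))

    crossed : Vertex → Vertex → Bool
    crossed u v = onDarts inside u v xor onDarts inside v u

    private
      -- Adding `inside` to this colouring cancels `crossed`, so that off the forest only the chord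
      -- separates different colours.
      solution = solve-off-tree (λ u v → edge u v xor crossed u v) λ u v →
        cong₂ _xor_ (edge-sym u v) (xor-comm (onDarts inside u v) (onDarts inside v u))

    χ : Fin #faces → Bool
    χ = proj₁ solution

    -- A colouring of sides rather than of faces: along the outer walk it jumps, but only at the two
    -- ends of the stretch.
    side : Side G → Bool
    side s = χ (face s) xor inside s

    side-step : ∀ {v w} (p : w ~ v) → side (step (dart w v p)) xor side (dart w v p) ≡ corner v (next v w)
    side-step {v} {w} p = trans (xor-interchange (χ (face (step s))) (inside (step s)) (χ (face s)) (inside s))
      (trans (cong (_xor (inside (step s) xor inside s)) (≡-xor (cong χ (face-step s)))) (inside-step s))
      where s = dart w v p

    sides : Vertex → Vertex → Bool
    sides u v = onDarts side u v xor onDarts side v u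

    sides-off-tree : ∀ u v → ¬ Child u v → ¬ Child v u → sides u v xor edge u v ≡ false
    sides-off-tree u v ¬c ¬c′ = case T? (adj u v) of λ where
        (yes p) → ≡-xor (adjacent p)
        (no ¬p) → cong₂ _xor_ (cong₂ _xor_ (onDarts-≁ side ¬p) (onDarts-≁ side (¬p ∘ ~-sym)))
                              (cong₂ _xor_ (at-≁ a~c ¬p) (at-≁ (~-sym a~c) ¬p))
      where
      split : ∀ {u v} → u ~ v → onDarts side u v ≡ onDarts (χ ∘ face) u v xor onDarts inside u v
      split p = trans (onDarts-~ side p) (sym (cong₂ _xor_ (onDarts-~ (χ ∘ face) p) (onDarts-~ inside p)))

      xor-cancelʳ : ∀ {x y} z → x ≡ y xor z → x xor z ≡ y
      xor-cancelʳ {y = y} z refl = trans (xor-assoc y z z) (trans (cong (y xor_) (xor-same z)) (xor-identityʳ y))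

      adjacent : u ~ v → sides u v ≡ edge u v
      adjacent p = begin
        sides u v                  ≡⟨ cong₂ _xor_ (split p) (split (~-sym p)) ⟩
        _                          ≡⟨ xor-interchange (onDarts (χ ∘ face) u v) (onDarts inside u v) (onDarts (χ ∘ face) v u) (onDarts inside v u) ⟩
        δ χ u v xor crossed u v    ≡⟨ xor-cancelʳ (crossed u v) (proj₂ solution p ¬c ¬c′) ⟩
        edge u v                   ∎
        where open ≡-Reasoning

    -- The difference lives on the forest and is even at every vertex, because the corner jumps of
    -- `side` occur at a and c, which are exactly the ends of the chord.
    sides-edge : ∀ u v → sides u v ≡ edge u v
    sides-edge u v = xor-≡ (forest-acyclic (λ u v → sides u v xor edge u v) symmetric sides-off-tree even u v)
      where
      symmetric : ∀ u v → sides u v xor edge u v ≡ sides v u xor edge v u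
      symmetric u v = cong₂ _xor_ (xor-comm (onDarts side u v) (onDarts side v u)) (edge-sym u v)

      sum-corner : ∀ v → sum (corner v) ≡ does (v Fin.≟ a) xor does (v Fin.≟ c)
      sum-corner v = trans (∑-distrib-+ {order} (at _ _ v) (at _ _ v)) (cong₂ _xor_
        (trans (sum-at (origin G (walk k i)) _ v) (cong (λ x → does (v Fin.≟ x)) (proj₁ visit-a)))
        (trans (sum-at (origin G (walk k l)) _ v) (cong (λ x → does (v Fin.≟ x)) (proj₁ visit-c))))

      sum-edge : ∀ v → sum (edge v) ≡ does (v Fin.≟ a) xor does (v Fin.≟ c)
      sum-edge v = trans (∑-distrib-+ {order} (at _ _ v) (at _ _ v)) (cong₂ _xor_ (sum-at a c v) (sum-at c a v))

      even : ∀ v → sum (λ w → sides v w xor edge v w) ≡ false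
      even v = trans (∑-distrib-+ {order} (sides v) (edge v)) (≡-xor (trans
        (sum-around side corner side-step
          (λ ¬p → cong₂ _xor_ (at-≁ (dart-from a~c (walk k i) (proj₁ visit-a)) ¬p)
                              (at-≁ (dart-from (~-sym a~c) (walk k l) (proj₁ visit-c)) ¬p)) v)
        (trans (sum-corner v) (sym (sum-edge v)))))

    module _ {b} (b≢a : b ≢ a) (b≢c : b ≢ c) where

      side-edge : ∀ w → onDarts side b w ≡ onDarts side w b
      side-edge w = xor-≡ (trans (sides-edge b w) (cong₂ _xor_ (at-≢ c b≢a w) (at-≢ a b≢c w)))

      -- No end of the chord and no jumping corner is at b, so all darts around b have one colour.
      side-constant : ∀ {w} → b ~ w → ∀ s → origin G s ≡ b → onDarts side b w ≡ side s
      side-constant {w} p (isolated _ q)  refl = ⊥-elim-irr (q w p)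
      side-constant {w} p (dart .b w′ q) refl = trans (next-invariant (onDarts side b) turn-const p b~w′) (onDarts-~ side b~w′)
        where
        b~w′ = recompute (T? (adj b w′)) q
        turn-const : ∀ {w} → b ~ w → onDarts side b (next b w) ≡ onDarts side b w
        turn-const {w} p = trans (onDarts-~ side (closed b w p)) (trans
          (xor-≡ (trans (side-step (~-sym p)) (cong₂ _xor_
            (at-≢ (target (walk k i)) (λ eq → b≢a (trans eq (proj₁ visit-a))) (next b w))
            (at-≢ (target (walk k l)) (λ eq → b≢c (trans eq (proj₁ visit-c))) (next b w)))))
          (trans (sym (onDarts-~ side (~-sym p))) (sym (side-edge w))))

  -- The dart at the first visit of b lies on the stretch and the one for d does not, yet both are
  -- on the outer face, so their colours differ. But the edge bd is not the chord and transports the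
  -- colour unchanged.
  no-crossing : ∀ {k a b c d i j l m} →
    FirstVisit k a i → FirstVisit k b j → FirstVisit k c l → FirstVisit k d m →
    i < j → j < l → l < m → a ~ c → b ~ d → ⊥
  no-crossing {k} {a} {b} {c} {d} {i} {j} {l} {m} visit-a visit-b visit-c visit-d i<j j<l l<m a~c b~d =
    true≢false (χ (outer k)) (trans (sym side-b) (trans (sym (side-constant b≢a b≢c b~d _ (proj₁ visit-b)))
      (trans (side-edge b≢a b≢c d) (trans (side-constant d≢a d≢c (~-sym b~d) _ (proj₁ visit-d)) side-d))))
    where
    open Chord a~c visit-a visit-c (<-trans i<j j<l)

    different : ∀ {x y i j} → FirstVisit k x i → FirstVisit k y j → i < j → y ≢ x
    different (at-x , _) (_ , first-y) i<j refl = first-y i<j at-x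

    b≢a = different visit-a visit-b i<j
    b≢c = different visit-b visit-c j<l ∘ sym
    d≢a = different visit-a visit-d (<-trans i<j (<-trans j<l l<m))
    d≢c = different visit-c visit-d l<m

    side-b : side (walk k j) ≡ χ (outer k) xor true
    side-b = cong₂ _xor_ (cong χ (walk-face k j)) (dec-true (inside? (walk k j)) (j , j<l , <⇒≤ i<j , refl))

    side-d : side (walk k m) ≡ χ (outer k) xor false
    side-d = cong₂ _xor_ (cong χ (walk-face k m)) (dec-false (inside? (walk k m)) λ where
      (m′ , m′<l , _ , eq) → distinct visit-d (<-trans m′<l l<m) ≤-refl eq)

    true≢false : ∀ x → ¬ (x xor true ≡ x xor false)
    true≢false false ()
    true≢false true  ()

-- Monotonic paths with two bends

-- The axes are true (horizontal) and false (vertical); `on b ℓ k` is the point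
-- number k of the line number ℓ in direction b.
on : Bool → ℕ → ℕ → Point
on true  ℓ k = k , ℓ
on false ℓ k = ℓ , k

move : Bool → Point → Point
move true  (x , y) = suc x , y
move false (x , y) = x , suc y

move-on : ∀ b ℓ k → move b (on b ℓ k) ≡ on b ℓ (suc k)
move-on true  ℓ k = refl
move-on false ℓ k = refl

on-not : ∀ b ℓ k → on (not b) ℓ k ≡ on b k ℓ
on-not true  ℓ k = refl
on-not false ℓ k = refl

trace after : Point → List Bool → List Point
trace p ds = p ∷ after p ds
after p []       = []
after p (d ∷ ds) = trace (move d p) ds

move-ascends : ∀ d p → Ascends p (move d p)
move-ascends true  p = right
move-ascends false p = up

trace-ascends : ∀ p ds → Linked Ascends (trace p ds)
trace-ascends p []       = [-]
trace-ascends p (d ∷ ds) = move-ascends d p ∷ trace-ascends (move d p) ds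

changes : List Bool → ℕ
changes (d ∷ e ∷ ds) = (if d xor e then 1 else 0) + changes (e ∷ ds)
changes _            = 0

isHorizontal-move : ∀ d p → isHorizontal p (move d p) ≡ d
isHorizontal-move true  (x , y) = dec-true (y ≟ y) refl
isHorizontal-move false (x , y) = dec-false (y ≟ suc y) (1+n≢n ∘ sym)

bendsOf-trace : ∀ p ds → bendsOf (trace p ds) ≡ changes ds
bendsOf-trace p []           = refl
bendsOf-trace p (d ∷ [])     = refl
bendsOf-trace p (d ∷ e ∷ ds) = cong₂ _+_
  (cong₂ (λ x y → if x xor y then 1 else 0) (isHorizontal-move d p) (isHorizontal-move e (move d p)))
  (bendsOf-trace (move d p) (e ∷ ds))

changes-∷ : ∀ d ds → changes (d ∷ ds) ≤ suc (changes ds)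
changes-∷ d []       = z≤n
changes-∷ d (e ∷ ds) with d xor e
... | true  = ≤-refl
... | false = n≤1+n _

-- Bends occur only between runs, so a run adds at most the one at its end.
changes-run : ∀ m b ds → changes (replicate m b ++ ds) ≤ suc (changes ds)
changes-run zero          b ds = n≤1+n _
changes-run (suc zero)    b ds = changes-∷ b ds
changes-run (suc (suc m)) b ds = subst (λ x → (if x then 1 else 0) + changes (replicate (suc m) b ++ ds) ≤ suc (changes ds))
  (sym (xor-same b)) (changes-run (suc m) b ds)

changes-replicate : ∀ m b → changes (replicate m b ++ []) ≡ 0
changes-replicate zero          b = refl
changes-replicate (suc zero)    b = refl
changes-replicate (suc (suc m)) b = trans (cong (λ x → (if x then 1 else 0) + changes (replicate (suc m) b ++ [])) (xor-same b))
  (changes-replicate (suc m) b)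

module Run (b : Bool) (ℓ : ℕ) {ds : List Bool} where

  Unit : ℕ → ℕ → Point → Point → Set
  Unit k l p q = ∃[ j ] k ≤ j × j < l × p ≡ on b ℓ j × q ≡ on b ℓ (suc j)

  run⁻ : ∀ {p q} m k → Consecutive p q (trace (on b ℓ k) (replicate m b ++ ds)) →
    Unit k (m + k) p q ⊎ Consecutive p q (trace (on b ℓ (m + k)) ds)
  run⁻ zero    k c    = inj₂ c
  run⁻ (suc m) k here = inj₁ (k , ≤-refl , s≤s (m≤n+m k m) , refl , move-on b ℓ k)
  run⁻ {p} {q} (suc m) k (there c) with run⁻ m (suc k)
    (subst (λ r → Consecutive p q (trace r (replicate m b ++ ds))) (move-on b ℓ k) c)
  ... | inj₁ (j , k<j , j<l , eqs) = inj₁ (j , <⇒≤ k<j , subst (j <_) (+-suc m k) j<l , eqs)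
  ... | inj₂ c′ = inj₂ (subst (λ i → Consecutive p q (trace (on b ℓ i) ds)) (+-suc m k) c′)

  run-skip : ∀ {p q} m k → Consecutive p q (trace (on b ℓ (m + k)) ds) →
    Consecutive p q (trace (on b ℓ k) (replicate m b ++ ds))
  run-skip zero    k c = c
  run-skip {p} {q} (suc m) k c = there (subst (λ r → Consecutive p q (trace r (replicate m b ++ ds))) (sym (move-on b ℓ k))
    (run-skip m (suc k) (subst (λ i → Consecutive p q (trace (on b ℓ i) ds)) (sym (+-suc m k)) c)))

  run⁺ : ∀ m k {j} → k ≤ j → j < m + k →
    Consecutive (on b ℓ j) (on b ℓ (suc j)) (trace (on b ℓ k) (replicate m b ++ ds))
  run⁺ zero    k k≤j j<k = contradiction k≤j (<⇒≱ j<k)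
  run⁺ (suc m) k {j} k≤j j<l with m≤n⇒m<n∨m≡n k≤j
  ... | inj₂ refl = subst (λ r → Consecutive (on b ℓ k) r (trace (on b ℓ k) (replicate (suc m) b ++ ds))) (move-on b ℓ k) here
  ... | inj₁ k<j  = there (subst (λ r → Consecutive (on b ℓ j) (on b ℓ (suc j)) (trace r (replicate m b ++ ds))) (sym (move-on b ℓ k))
                      (run⁺ m (suc k) k<j (subst (j <_) (sym (+-suc m k)) j<l)))

-- A path with a middle segment on its own line `mid`, and (possibly empty) end
-- segments on the lines `from` and `to`, which run in the other direction.
record Shape : Set where
  field
    axis          : Bool
    start mid end : ℕ
    from to       : ℕ
    start≤mid     : start ≤ mid
    mid≤end       : mid ≤ end
    from≤to       : from ≤ to

-- Grid edges are named by direction, line and lower coordinate j, which turns sharing an edge into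
-- equations and inequalities.
data Occupies (S : Shape) (b : Bool) (ℓ j : ℕ) : Set where
  first  : b ≡ not (Shape.axis S) → ℓ ≡ Shape.from S → Shape.start S ≤ j → j < Shape.mid S → Occupies S b ℓ j
  middle : b ≡ Shape.axis S → ℓ ≡ Shape.mid S → Shape.from S ≤ j → j < Shape.to S → Occupies S b ℓ j
  last   : b ≡ not (Shape.axis S) → ℓ ≡ Shape.to S → Shape.mid S ≤ j → j < Shape.end S → Occupies S b ℓ j

module _ (S : Shape) where
  open Shape S

  private
    run₃ run₂ run₁ : List Bool
    run₃ = replicate (end ∸ mid) (not axis) ++ []
    run₂ = replicate (to ∸ from) axis ++ run₃
    run₁ = replicate (mid ∸ start) (not axis) ++ run₂

    corner₁ : on (not axis) from (mid ∸ start + start) ≡ on axis mid from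
    corner₁ = trans (on-not axis from _) (cong (λ k → on axis k from) (m∸n+n≡m start≤mid))

    corner₂ : on axis mid (to ∸ from + from) ≡ on (not axis) to mid
    corner₂ = trans (cong (on axis mid) (m∸n+n≡m from≤to)) (sym (on-not axis to mid))

  pathPoints : List Point
  pathPoints = trace (on (not axis) from start) run₁

  toPath : Path
  toPath = record
    { points   = pathPoints
    ; nonEmpty = λ ()
    ; joined   = Linked.map inj₁ (trace-ascends _ run₁)
    }

  toPath-monotonic : Monotonic toPath
  toPath-monotonic = inj₁ (trace-ascends _ run₁)

  toPath-bends : bends toPath ≤ 2
  toPath-bends = begin
    bendsOf pathPoints      ≡⟨ bendsOf-trace _ run₁ ⟩
    changes run₁            ≤⟨ changes-run (mid ∸ start) (not axis) run₂ ⟩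
    suc (changes run₂)      ≤⟨ s≤s (changes-run (to ∸ from) axis run₃) ⟩
    2 + changes run₃        ≡⟨ cong (2 +_) (changes-replicate (end ∸ mid) (not axis)) ⟩
    2                       ∎
    where open ≤-Reasoning hiding (start)

  toPath⁻ : ∀ {p q} → Consecutive p q pathPoints →
    ∃[ b ] ∃[ ℓ ] ∃[ j ] Occupies S b ℓ j × p ≡ on b ℓ j × q ≡ on b ℓ (suc j)
  toPath⁻ {p} {q} c with Run.run⁻ (not axis) from (mid ∸ start) start c
  ... | inj₁ (j , ge , lt , eqs) = not axis , from , j , first refl refl ge (subst (j <_) (m∸n+n≡m start≤mid) lt) , eqs
  ... | inj₂ c₂ with Run.run⁻ axis mid (to ∸ from) from (subst (λ r → Consecutive p q (trace r run₂)) corner₁ c₂)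
  ...   | inj₁ (j , ge , lt , eqs) = axis , mid , j , middle refl refl ge (subst (j <_) (m∸n+n≡m from≤to) lt) , eqs
  ...   | inj₂ c₃ with Run.run⁻ (not axis) to (end ∸ mid) mid (subst (λ r → Consecutive p q (trace r run₃)) corner₂ c₃)
  ...     | inj₁ (j , ge , lt , eqs) = not axis , to , j , last refl refl ge (subst (j <_) (m∸n+n≡m mid≤end) lt) , eqs
  ...     | inj₂ (there ())

  toPath⁺ : ∀ {b ℓ j} → Occupies S b ℓ j → Consecutive (on b ℓ j) (on b ℓ (suc j)) pathPoints
  toPath⁺ {j = j} (first refl refl ge lt) = Run.run⁺ (not axis) from (mid ∸ start) start ge (subst (j <_) (sym (m∸n+n≡m start≤mid)) lt)
  toPath⁺ {j = j} (middle refl refl ge lt) = Run.run-skip (not axis) from (mid ∸ start) start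
    (subst (λ r → Consecutive (on axis mid j) (on axis mid (suc j)) (trace r run₂)) (sym corner₁)
      (Run.run⁺ axis mid (to ∸ from) from ge (subst (j <_) (sym (m∸n+n≡m from≤to)) lt)))
  toPath⁺ {j = j} (last refl refl ge lt) = Run.run-skip (not axis) from (mid ∸ start) start
    (subst (λ r → Consecutive (on (not axis) to j) (on (not axis) to (suc j)) (trace r run₂)) (sym corner₁)
      (Run.run-skip axis mid (to ∸ from) from
        (subst (λ r → Consecutive (on (not axis) to j) (on (not axis) to (suc j)) (trace r run₃)) (sym corner₂)
          (Run.run⁺ (not axis) to (end ∸ mid) mid ge (subst (j <_) (sym (m∸n+n≡m mid≤end)) lt)))))

on-injective : ∀ {b ℓ j} b′ {ℓ′ j′} → on b ℓ j ≡ on b′ ℓ′ j′ → on b ℓ (suc j) ≡ on b′ ℓ′ (suc j′) →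
  b ≡ b′ × ℓ ≡ ℓ′ × j ≡ j′
on-injective {true}  true  refl refl = refl , refl , refl
on-injective {true}  false refl ()
on-injective {false} true  refl ()
on-injective {false} false refl refl = refl , refl , refl

-- Rules out that two ascending paths traverse a shared edge in opposite directions.
on-directed : ∀ {b ℓ j} b′ {ℓ′ j′} → on b ℓ j ≡ on b′ ℓ′ (suc j′) → ¬ on b ℓ (suc j) ≡ on b′ ℓ′ j′
on-directed {true}  true  refl ()
on-directed {true}  false refl ()
on-directed {false} true  refl ()
on-directed {false} false refl ()

toPath-intersect : ∀ S S′ → Intersect (toPath S) (toPath S′) ⇔ (∃[ b ] ∃[ ℓ ] ∃[ j ] Occupies S b ℓ j × Occupies S′ b ℓ j)
toPath-intersect S S′ = mk⇔ (λ where
    (_ , _ , inj₁ c , inj₁ c′) → parallel c c′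
    (_ , _ , inj₂ c , inj₂ c′) → parallel c c′
    (_ , _ , inj₁ c , inj₂ c′) → opposite c c′
    (_ , _ , inj₂ c , inj₁ c′) → opposite c c′)
  λ (b , ℓ , j , o , o′) → _ , _ , inj₁ (toPath⁺ S o) , inj₁ (toPath⁺ S′ o′)
  where
  Common : Set
  Common = ∃[ b ] ∃[ ℓ ] ∃[ j ] Occupies S b ℓ j × Occupies S′ b ℓ j

  parallel : ∀ {p q} → Consecutive p q (pathPoints S) → Consecutive p q (pathPoints S′) → Common
  parallel c c′ with toPath⁻ S c | toPath⁻ S′ c′
  ... | b , ℓ , j , o , refl , refl | b′ , ℓ′ , j′ , o′ , eq , eq′ with on-injective {b} b′ eq eq′
  ...   | refl , refl , refl = b , ℓ , j , o , o′

  opposite : ∀ {p q} → Consecutive p q (pathPoints S) → Consecutive q p (pathPoints S′) → Common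
  opposite c c′ with toPath⁻ S c | toPath⁻ S′ c′
  ... | b , ℓ , j , o , refl , refl | b′ , ℓ′ , j′ , o′ , eq , eq′ = contradiction eq (on-directed {b} b′ eq′)

-- Drawing a one-page layered graph

argmax : ∀ {n} (f : Fin n → ℕ) {P : Fin n → Set} → Decidable P → ∃[ i ] P i →
  ∃[ i ] P i × (∀ j → P j → f j ≤ f i)
argmax {suc n} f {P} P? (i , p) with Fin.any? (P? ∘ suc)
... | no none = zero , P-zero i p , λ where
    zero    _ → ≤-refl
    (suc j) q → contradiction (j , q) none
  where
  P-zero : ∀ i → P i → P zero
  P-zero zero    p = p
  P-zero (suc i) p = contradiction (i , p) none
... | yes some with argmax (f ∘ suc) (P? ∘ suc) some
...   | k , pk , max with P? zero
...     | no ¬p₀ = suc k , pk , λ where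
            zero    q → contradiction q ¬p₀
            (suc j) q → max j q
...     | yes p₀ with ≤-total (f zero) (f (suc k))
...       | inj₁ le = suc k , pk , λ where
              zero    _ → le
              (suc j) q → max j q
...       | inj₂ ge = zero , p₀ , λ where
              zero    _ → ≤-refl
              (suc j) q → ≤-trans (max j q) ge

even : ℕ → Bool
even zero    = true
even (suc n) = not (even n)

4*-separates : ∀ {r s} → r < 4 → s < 4 → r ≢ s → ∀ m n → ¬ (r + 4 * m ≡ s + 4 * n)
4*-separates {r} {s} r<4 s<4 r≢s m n eq = r≢s (begin
  r                 ≡⟨ m<n⇒m%n≡m r<4 ⟨
  r % 4             ≡⟨ [m+kn]%n≡m%n r m 4 ⟨
  (r + m * 4) % 4   ≡⟨ cong (_% 4) (trans (cong (r +_) (*-comm m 4)) (trans eq (cong (s +_) (*-comm 4 n)))) ⟩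
  (s + n * 4) % 4   ≡⟨ [m+kn]%n≡m%n s n 4 ⟩
  s % 4             ≡⟨ m<n⇒m%n≡m s<4 ⟩
  s                 ∎)
  where
  open ≡-Reasoning

-- All that the drawing needs to know: a one-page book embedding and a breadth-first layering whose
-- roots lie under no edge.
record OnePageLayering (G : Graph) : Set where
  open Graph G using (Vertex; _~_)
  field
    pos           : Vertex → ℕ
    pos-injective : ∀ {u v} → pos u ≡ pos v → u ≡ v
    no-crossing   : ∀ {a b c d} → pos a < pos b → pos b < pos c → pos c < pos d → a ~ c → b ~ d → ⊥
    layer         : Vertex → ℕ
    layer-suc     : ∀ v → layer v ≡ 0 ⊎ ∃[ w ] v ~ w × layer v ≡ suc (layer w)
    layer-step    : ∀ {u v} → u ~ v → layer u ≤ suc (layer v)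
    uncovered     : ∀ {a x c} → layer x ≡ 0 → a ~ c → pos a < pos x → pos x < pos c → ⊥

module Layout (G : Graph) (layering : OnePageLayering G) where
  open Graph G using (Vertex; _~_; adj)
  open GraphProperties G
  open OnePageLayering layering

  _≺_ : Vertex → Vertex → Set
  u ≺ v = pos u < pos v

  data Order (u v : Vertex) : Set where
    before : u ≺ v → Order u v
    same   : u ≡ v → Order u v
    behind : v ≺ u → Order u v

  order : ∀ u v → Order u v
  order u v with <-cmp (pos u) (pos v)
  ... | tri< u<v _ _ = before u<v
  ... | tri≈ _ u≡v _ = same (pos-injective u≡v)
  ... | tri> _ _ v<u = behind v<u

  -- Descend from x to a neighbour in the previous layer. It cannot leave the interval without
  -- crossing ac, and its layer is too small for a or c; so the descent ends at a root under the
  -- edge.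
  covered : ∀ {a x c} → a ~ c → a ≺ x → x ≺ c → layer x ≤ layer a → layer x ≤ layer c → ⊥
  covered {a} {x} {c} a~c = go (layer x) refl
    where
    go : ∀ m {x} → layer x ≡ m → a ≺ x → x ≺ c → layer x ≤ layer a → layer x ≤ layer c → ⊥
    go zero    eq a≺x x≺c _ _ = uncovered eq a~c a≺x x≺c
    go (suc m) {x} eq a≺x x≺c x≤a x≤c with layer-suc x
    ... | inj₁ z = contradiction (trans (sym z) eq) λ ()
    ... | inj₂ (w , x~w , above) with order w a | order w c
    ...   | before w≺a | _          = no-crossing w≺a a≺x x≺c (~-sym x~w) a~c
    ...   | same refl  | _          = 1+n≰n (subst (_≤ layer a) above x≤a)
    ...   | behind _   | same refl  = 1+n≰n (subst (_≤ layer c) above x≤c)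
    ...   | behind _   | behind c≺w = no-crossing a≺x x≺c c≺w a~c x~w
    ...   | behind a≺w | before w≺c = go m (suc-injective (trans (sym above) eq)) a≺w w≺c
              (≤-trans w≤x x≤a) (≤-trans w≤x x≤c)
      where
      w≤x : layer w ≤ layer x
      w≤x = ≤-trans (n≤1+n _) (≤-reflexive (sym above))

  -- Neighbours in the same and the previous layer

  Parent : Vertex → Vertex → Set
  Parent v a = v ~ a × layer v ≡ suc (layer a)

  Sibling : Vertex → Vertex → Set
  Sibling v w = v ~ w × layer v ≡ layer w

  LeftParent RightParent LeftSibling RightSibling : Vertex → Vertex → Set
  LeftParent   v a = Parent v a × a ≺ v
  RightParent  v b = Parent v b × v ≺ b
  LeftSibling  v w = Sibling v w × w ≺ v
  RightSibling v w = Sibling v w × v ≺ w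

  parent? : ∀ v a → Dec (Parent v a)
  parent? v a = T? (adj v a) ×-dec (layer v ≟ suc (layer a))

  sibling? : ∀ v w → Dec (Sibling v w)
  sibling? v w = T? (adj v w) ×-dec (layer v ≟ layer w)

  leftParent? : ∀ v → Dec (∃[ a ] LeftParent v a)
  leftParent? v = Fin.any? λ a → parent? v a ×-dec (pos a <? pos v)

  rightParent? : ∀ v → Dec (∃[ b ] RightParent v b)
  rightParent? v = Fin.any? λ b → parent? v b ×-dec (pos v <? pos b)

  leftSibling? : ∀ v → Dec (∃[ w ] LeftSibling v w)
  leftSibling? v = Fin.any? λ w → sibling? v w ×-dec (pos w <? pos v)

  rightSibling? : ∀ v → Dec (∃[ w ] RightSibling v w)
  rightSibling? v = Fin.any? λ w → sibling? v w ×-dec (pos v <? pos w)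

  sibling-sym : ∀ {v w} → Sibling v w → Sibling w v
  sibling-sym (v~w , eq) = ~-sym v~w , sym eq

  parent-≤ : ∀ {v a} → Parent v a → layer a ≤ layer v
  parent-≤ (_ , eq) = ≤-trans (n≤1+n _) (≤-reflexive (sym eq))

  parent-≰ : ∀ {v a} → Parent v a → ¬ layer v ≤ layer a
  parent-≰ (_ , eq) le = 1+n≰n (≤-trans (≤-reflexive (sym eq)) le)

  -- Otherwise the nearer of the two would lie under the edge from v to the farther one, against
  -- `covered`.
  unique-left : ∀ {v a a′} → v ~ a → v ~ a′ → layer a ≡ layer a′ → layer a ≤ layer v → a ≺ v → a′ ≺ v → a ≡ a′
  unique-left {v} {a} {a′} v~a v~a′ eq a≤v a≺v a′≺v with order a a′
  ... | before a≺a′ = ⊥-elim (covered (~-sym v~a) a≺a′ a′≺v (≤-reflexive (sym eq)) (subst (_≤ layer v) eq a≤v))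
  ... | same a≡a′   = a≡a′
  ... | behind a′≺a = ⊥-elim (covered (~-sym v~a′) a′≺a a≺v (≤-reflexive eq) a≤v)

  unique-right : ∀ {v a a′} → v ~ a → v ~ a′ → layer a ≡ layer a′ → layer a ≤ layer v → v ≺ a → v ≺ a′ → a ≡ a′
  unique-right {v} {a} {a′} v~a v~a′ eq a≤v v≺a v≺a′ with order a a′
  ... | before a≺a′ = ⊥-elim (covered v~a′ v≺a a≺a′ a≤v (≤-reflexive eq))
  ... | same a≡a′   = a≡a′
  ... | behind a′≺a = ⊥-elim (covered v~a v≺a′ a′≺a (subst (_≤ layer v) eq a≤v) (≤-reflexive (sym eq)))

  leftParent-unique : ∀ {v a a′} → LeftParent v a → LeftParent v a′ → a ≡ a′
  leftParent-unique (p , a≺v) (p′ , a′≺v) =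
    unique-left (proj₁ p) (proj₁ p′) (suc-injective (trans (sym (proj₂ p)) (proj₂ p′))) (parent-≤ p) a≺v a′≺v

  rightParent-unique : ∀ {v a a′} → RightParent v a → RightParent v a′ → a ≡ a′
  rightParent-unique (p , v≺a) (p′ , v≺a′) =
    unique-right (proj₁ p) (proj₁ p′) (suc-injective (trans (sym (proj₂ p)) (proj₂ p′))) (parent-≤ p) v≺a v≺a′

  leftSibling-unique : ∀ {v w w′} → LeftSibling v w → LeftSibling v w′ → w ≡ w′
  leftSibling-unique ((e , eq) , w≺v) ((e′ , eq′) , w′≺v) =
    unique-left e e′ (trans (sym eq) eq′) (≤-reflexive (sym eq)) w≺v w′≺v

  rightSibling-unique : ∀ {v w w′} → RightSibling v w → RightSibling v w′ → w ≡ w′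
  rightSibling-unique ((e , eq) , v≺w) ((e′ , eq′) , v≺w′) =
    unique-right e e′ (trans (sym eq) eq′) (≤-reflexive (sym eq)) v≺w v≺w′

  -- Otherwise b would lie under the edge vd. `inner-left` is the mirror image.
  inner-right : ∀ {d v b} → Parent d v → v ≺ d → v ≺ b → layer b ≤ layer v → d ≺ b
  inner-right {d} {v} {b} p v≺d v≺b b≤v with order d b
  ... | before d≺b = d≺b
  ... | same refl  = contradiction b≤v (parent-≰ p)
  ... | behind b≺d = ⊥-elim (covered (~-sym (proj₁ p)) v≺b b≺d b≤v (≤-trans b≤v (parent-≤ p)))

  inner-left : ∀ {d v b} → Parent d v → d ≺ v → b ≺ v → layer b ≤ layer v → b ≺ d
  inner-left {d} {v} {b} p d≺v b≺v b≤v with order d b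
  ... | before d≺b = ⊥-elim (covered (proj₁ p) d≺b b≺v (≤-trans b≤v (parent-≤ p)) b≤v)
  ... | same refl  = contradiction b≤v (parent-≰ p)
  ... | behind b≺d = b≺d

  -- By `covered`, a is not under the edge wv, so w lies under av. A neighbour of w in the previous
  -- layer cannot lie beyond a or v without a crossing, nor strictly between them by `covered`; only
  -- a remains.
  share-left : ∀ {v w a} → LeftSibling v w → LeftParent v a → LeftParent w a
  share-left {v} {w} {a} ((v~w , eq) , w≺v) (p@(v~a , above) , a≺v) with order a w
  ... | same refl  = contradiction (≤-reflexive eq) (parent-≰ p)
  ... | behind w≺a = ⊥-elim (covered (~-sym v~w) w≺a a≺v (subst (layer a ≤_) eq (parent-≤ p)) (parent-≤ p))
  ... | before a≺w with layer-suc w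
  ...   | inj₁ z = contradiction (trans (sym above) (trans eq z)) λ ()
  ...   | inj₂ (b , w~b , aboveᵇ) with order b a | order b v
  ...     | before b≺a | _          = ⊥-elim (no-crossing b≺a a≺w w≺v (~-sym w~b) (~-sym v~a))
  ...     | same refl  | _          = (w~b , aboveᵇ) , a≺w
  ...     | behind _   | same refl  = contradiction (≤-reflexive (sym eq)) (parent-≰ (w~b , aboveᵇ))
  ...     | behind _   | behind v≺b = ⊥-elim (no-crossing a≺w w≺v v≺b (~-sym v~a) w~b)
  ...     | behind a≺b | before b≺v = ⊥-elim (covered (~-sym v~a) a≺b b≺v
              (≤-reflexive (suc-injective (trans (sym aboveᵇ) (trans (sym eq) above)))) (subst (layer b ≤_) (sym eq) (parent-≤ (w~b , aboveᵇ))))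

  share-right : ∀ {v w b} → RightSibling v w → RightParent v b → RightParent w b
  share-right {v} {w} {b} ((v~w , eq) , v≺w) (p@(v~b , above) , v≺b) with order w b
  ... | same refl  = contradiction (≤-reflexive eq) (parent-≰ p)
  ... | behind b≺w = ⊥-elim (covered v~w v≺b b≺w (parent-≤ p) (subst (layer b ≤_) eq (parent-≤ p)))
  ... | before w≺b with layer-suc w
  ...   | inj₁ z = contradiction (trans (sym above) (trans eq z)) λ ()
  ...   | inj₂ (a , w~a , aboveᵃ) with order a b | order a v
  ...     | behind b≺a | _          = ⊥-elim (no-crossing v≺w w≺b b≺a v~b w~a)
  ...     | same refl  | _          = (w~a , aboveᵃ) , w≺b
  ...     | before _   | same refl  = contradiction (≤-reflexive (sym eq)) (parent-≰ (w~a , aboveᵃ))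
  ...     | before _   | before a≺v = ⊥-elim (no-crossing a≺v v≺w w≺b (~-sym w~a) v~b)
  ...     | before a≺b | behind v≺a = ⊥-elim (covered v~b v≺a a≺b (subst (layer a ≤_) (sym eq) (parent-≤ (w~a , aboveᵃ)))
              (≤-reflexive (suc-injective (trans (sym aboveᵃ) (trans (sym eq) above)))))

  -- Each vertex v has the coordinates 1 + block v to 4 + block v: segments begin at
  -- offset 1 and end at offset 4, lines lie at offsets 2 and 3.
  block : Vertex → ℕ
  block v = 4 * pos v

  -- Distinct blocks are at least 4 apart, so comparing across blocks reduces to comparing offsets,
  -- which is settled by evaluation.
  near : ∀ k m {u v} {_ : T (k ≤ᵇ 4 + m)} → u ≺ v → k + block u ≤ m + block v
  near k m {u} {v} {k≤} u≺v = begin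
    k + block u           ≤⟨ +-monoˡ-≤ (block u) (≤ᵇ⇒≤ k (4 + m) k≤) ⟩
    4 + m + block u       ≡⟨ cong (_+ block u) (+-comm 4 m) ⟩
    m + 4 + block u       ≡⟨ +-assoc m 4 (block u) ⟩
    m + (4 + block u)     ≡⟨ cong (m +_) (*-suc 4 (pos u)) ⟨
    m + 4 * suc (pos u)   ≤⟨ +-monoʳ-≤ m (*-monoʳ-≤ 4 u≺v) ⟩
    m + block v           ∎
    where open ≤-Reasoning

  within : ∀ k m v {_ : T (k ≤ᵇ m)} → k + block v ≤ m + block v
  within k m v {k≤m} = +-monoˡ-≤ (block v) (≤ᵇ⇒≤ k m k≤m)

  block-mono : ∀ m {u v} → pos u ≤ pos v → m + block u ≤ m + block v
  block-mono m u≤v = +-monoʳ-≤ m (*-monoʳ-≤ 4 u≤v)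

  block-injective : ∀ m {u v} → m + block u ≡ m + block v → u ≡ v
  block-injective m {u} {v} eq = pos-injective (*-cancelˡ-≡ (pos u) (pos v) 4 (+-cancelˡ-≡ m (block u) (block v) eq))

  -- The line of v has to extend past all its children on the right; v itself is included so that a
  -- last one always exists.
  OuterChild : Vertex → Vertex → Set
  OuterChild v d = d ≡ v ⊎ LeftParent d v

  lastChildOf : ∀ v → ∃[ d ] OuterChild v d × (∀ x → OuterChild v x → pos x ≤ pos d)
  lastChildOf v = argmax pos (λ d → (d Fin.≟ v) ⊎-dec (parent? d v ×-dec (pos v <? pos d))) (v , inj₁ refl)

  lastChild : Vertex → Vertex
  lastChild v = proj₁ (lastChildOf v)

  ≤-lastChild : ∀ {v d} → OuterChild v d → pos d ≤ pos (lastChild v)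
  ≤-lastChild {v} {d} = proj₂ (proj₂ (lastChildOf v)) d

  -- The line of a vertex, and the line on which a vertex meets its right sibling
  -- if they have no parent on a suitable side to meet on.
  own meet : Vertex → ℕ
  own v  = 2 + block v
  meet v = 3 + block (lastChild v)

  own≢meet : ∀ {u v} → ¬ own u ≡ meet v
  own≢meet {u} {v} = 4*-separates (s≤s (s≤s (s≤s z≤n))) (s≤s (s≤s (s≤s (s≤s z≤n)))) (λ ()) (pos u) (pos (lastChild v))

  axisOf : Vertex → Bool
  axisOf v = even (layer v)

  parent-axis : ∀ {v a} → Parent v a → axisOf a ≡ not (axisOf v)
  parent-axis {v} {a} (_ , eq) = sym (trans (cong (not ∘ even) eq) (not-involutive _))

  sibling-axis : ∀ {v w} → Sibling v w → axisOf v ≡ axisOf w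
  sibling-axis (_ , eq) = cong even eq

  not-≢ : ∀ b → b ≢ not b
  not-≢ false ()
  not-≢ true  ()

  -- A common last child has only one left parent; that one vertex is a child of the other is
  -- excluded by the parity of the layers.
  meet-injective : ∀ {v w} → axisOf v ≡ axisOf w → meet v ≡ meet w → v ≡ w
  meet-injective {v} {w} axes eq = go (proj₁ (proj₂ (lastChildOf v))) (proj₁ (proj₂ (lastChildOf w))) (block-injective 3 eq)
    where
    go : ∀ {d e} → OuterChild v d → OuterChild w e → d ≡ e → v ≡ w
    go (inj₁ refl) (inj₁ refl) eq   = eq
    go (inj₁ refl) (inj₂ p)    refl = contradiction (trans axes (parent-axis (proj₁ p))) (not-≢ _)
    go (inj₂ p)    (inj₁ refl) refl = contradiction (trans (sym axes) (parent-axis (proj₁ p))) (not-≢ _)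
    go (inj₂ p)    (inj₂ q)    refl = leftParent-unique p q

  lastChild-≺ : ∀ {v w} → RightSibling v w → lastChild v ≺ w
  lastChild-≺ {v} {w} ((_ , eq) , v≺w) = go (proj₁ (proj₂ (lastChildOf v)))
    where
    go : ∀ {d} → OuterChild v d → d ≺ w
    go (inj₁ refl)      = v≺w
    go (inj₂ (p , v≺d)) = inner-right p v≺d v≺w (≤-reflexive (sym eq))

  swapˡ : ∀ {v w} → LeftSibling v w → RightSibling w v
  swapˡ (s , w≺v) = sibling-sym s , w≺v

  -- A parent takes precedence in choosing the line of an end segment, a sibling in choosing its
  -- length, as the segment must reach the block of the sibling. The decisions are arguments so that
  -- proofs can split on them.
  fromOf startOf : ∀ v → Dec (∃[ a ] LeftParent v a) → Dec (∃[ w ] LeftSibling v w) → ℕ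
  fromOf v (yes (a , _)) _             = own a
  fromOf v (no _)        (yes (w , _)) = meet w
  -- With nothing to meet on the left, the line of v starts at the border of the grid, and `startOf`
  -- makes the first segment empty.
  fromOf v (no _)        (no _)        = 0
  startOf v _       (yes (w , _)) = 1 + block w
  startOf v (yes _) (no _)        = 1 + block v
  startOf v (no _)  (no _)        = own v

  toOf endOf : ∀ v → Dec (∃[ b ] RightParent v b) → Dec (∃[ w ] RightSibling v w) → ℕ
  toOf v (yes (b , _)) _       = own b
  toOf v (no _)        (yes _) = meet v
  -- The end of the last block, beyond the lines of all children on the right.
  toOf v (no _)        (no _)  = 4 + 4 * maximum pos
  endOf v _       (yes (w , _)) = 4 + block w
  endOf v (yes _) (no _)        = 4 + block v
  endOf v (no _)  (no _)        = own v

  from start to end : Vertex → ℕ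
  from  v = fromOf v (leftParent? v) (leftSibling? v)
  start v = startOf v (leftParent? v) (leftSibling? v)
  to    v = toOf v (rightParent? v) (rightSibling? v)
  end   v = endOf v (rightParent? v) (rightSibling? v)

  data Incoming (v : Vertex) : Set where
    parent  : ∀ {a} → LeftParent v a → from v ≡ own a → Incoming v
    sibling : ∀ {w} → LeftSibling v w → from v ≡ meet w → Incoming v
    nothing : start v ≡ own v → from v ≡ 0 → Incoming v

  incoming : ∀ v → Incoming v
  incoming v = go (leftParent? v) (leftSibling? v) refl refl
    where
    go : ∀ p s → from v ≡ fromOf v p s → start v ≡ startOf v p s → Incoming v
    go (yes (a , p)) _             eq _   = parent p eq
    go (no _)        (yes (w , s)) eq _   = sibling s eq
    go (no _)        (no _)        eq eq′ = nothing eq′ eq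

  data Outgoing (v : Vertex) : Set where
    parent  : ∀ {b} → RightParent v b → to v ≡ own b → Outgoing v
    sibling : ∀ {w} → RightSibling v w → to v ≡ meet v → Outgoing v
    nothing : end v ≡ own v → to v ≡ 4 + 4 * maximum pos → Outgoing v

  outgoing : ∀ v → Outgoing v
  outgoing v = go (rightParent? v) (rightSibling? v) refl refl
    where
    go : ∀ p s → to v ≡ toOf v p s → end v ≡ endOf v p s → Outgoing v
    go (yes (b , p)) _             eq _   = parent p eq
    go (no _)        (yes (w , s)) eq _   = sibling s eq
    go (no _)        (no _)        eq eq′ = nothing eq′ eq

  from-parent : ∀ {v a} → LeftParent v a → from v ≡ own a
  from-parent {v} {a} p = go (leftParent? v) (leftSibling? v)
    where
    go : ∀ p s → fromOf v p s ≡ own a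
    go (yes (a′ , p′)) _ = cong own (leftParent-unique p′ p)
    go (no ¬p)         _ = contradiction (a , p) ¬p

  from-sibling : ∀ {v w} → ¬ (∃[ a ] LeftParent v a) → LeftSibling v w → from v ≡ meet w
  from-sibling {v} {w} ¬p s = go (leftParent? v) (leftSibling? v)
    where
    go : ∀ p s → fromOf v p s ≡ meet w
    go (yes p) _               = contradiction p ¬p
    go (no _)  (yes (w′ , s′)) = cong meet (leftSibling-unique s′ s)
    go (no _)  (no ¬s)         = contradiction (w , s) ¬s

  start-sibling : ∀ {v w} → LeftSibling v w → start v ≡ 1 + block w
  start-sibling {v} {w} s = go (leftParent? v) (leftSibling? v)
    where
    go : ∀ p s → startOf v p s ≡ 1 + block w
    go _ (yes (w′ , s′)) = cong (λ x → 1 + block x) (leftSibling-unique s′ s)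
    go _ (no ¬s)         = contradiction (w , s) ¬s

  start-parent : ∀ {v a} → LeftParent v a → start v ≤ 1 + block v
  start-parent {v} {a} p = go (leftParent? v) (leftSibling? v)
    where
    go : ∀ p s → startOf v p s ≤ 1 + block v
    go _       (yes (w , _ , w≺v)) = near 1 1 w≺v
    go (yes _) (no _)              = ≤-refl
    go (no ¬p) (no _)              = contradiction (a , p) ¬p

  start-≥ : ∀ v → (∃[ w ] LeftSibling v w × start v ≡ 1 + block w) ⊎ 1 + block v ≤ start v
  start-≥ v = go (leftParent? v) (leftSibling? v)
    where
    go : ∀ p s → (∃[ w ] LeftSibling v w × startOf v p s ≡ 1 + block w) ⊎ 1 + block v ≤ startOf v p s
    go _       (yes (w , s)) = inj₁ (w , s , refl)
    go (yes _) (no _)        = inj₂ ≤-refl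
    go (no _)  (no _)        = inj₂ (within 1 2 v)

  start≤own : ∀ v → start v ≤ own v
  start≤own v = go (leftParent? v) (leftSibling? v)
    where
    go : ∀ p s → startOf v p s ≤ own v
    go _       (yes (w , _ , w≺v)) = near 1 2 w≺v
    go (yes _) (no _)              = within 1 2 v
    go (no _)  (no _)              = ≤-refl

  to-parent : ∀ {v b} → RightParent v b → to v ≡ own b
  to-parent {v} {b} p = go (rightParent? v) (rightSibling? v)
    where
    go : ∀ p s → toOf v p s ≡ own b
    go (yes (b′ , p′)) _ = cong own (rightParent-unique p′ p)
    go (no ¬p)         _ = contradiction (b , p) ¬p

  to-sibling : ∀ {v w} → ¬ (∃[ b ] RightParent v b) → RightSibling v w → to v ≡ meet v
  to-sibling {v} {w} ¬p s = go (rightParent? v) (rightSibling? v)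
    where
    go : ∀ p s → toOf v p s ≡ meet v
    go (yes p) _       = contradiction p ¬p
    go (no _)  (yes _) = refl
    go (no _)  (no ¬s) = contradiction (w , s) ¬s

  end-sibling : ∀ {v w} → RightSibling v w → end v ≡ 4 + block w
  end-sibling {v} {w} s = go (rightParent? v) (rightSibling? v)
    where
    go : ∀ p s → endOf v p s ≡ 4 + block w
    go _ (yes (w′ , s′)) = cong (λ x → 4 + block x) (rightSibling-unique s′ s)
    go _ (no ¬s)         = contradiction (w , s) ¬s

  end-parent : ∀ {v b} → RightParent v b → 4 + block v ≤ end v
  end-parent {v} {b} p = go (rightParent? v) (rightSibling? v)
    where
    go : ∀ p s → 4 + block v ≤ endOf v p s
    go _       (yes (w , _ , v≺w)) = near 4 4 v≺w
    go (yes _) (no _)              = ≤-refl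
    go (no ¬p) (no _)              = contradiction (b , p) ¬p

  end-≤ : ∀ v → (∃[ w ] RightSibling v w × end v ≡ 4 + block w) ⊎ end v ≤ 4 + block v
  end-≤ v = go (rightParent? v) (rightSibling? v)
    where
    go : ∀ p s → (∃[ w ] RightSibling v w × endOf v p s ≡ 4 + block w) ⊎ endOf v p s ≤ 4 + block v
    go _       (yes (w , s)) = inj₁ (w , s , refl)
    go (yes _) (no _)        = inj₂ ≤-refl
    go (no _)  (no _)        = inj₂ (within 2 4 v)

  own≤end : ∀ v → own v ≤ end v
  own≤end v = go (rightParent? v) (rightSibling? v)
    where
    go : ∀ p s → own v ≤ endOf v p s
    go _       (yes (w , _ , v≺w)) = near 2 4 v≺w
    go (yes _) (no _)              = within 2 4 v
    go (no _)  (no _)              = ≤-refl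

  from≤own : ∀ v → from v ≤ own v
  from≤own v with incoming v
  ... | parent (_ , a≺v) eq = ≤-trans (≤-reflexive eq) (near 2 2 a≺v)
  ... | sibling s eq        = ≤-trans (≤-reflexive eq) (near 3 2 (lastChild-≺ (swapˡ s)))
  ... | nothing _ eq        = ≤-trans (≤-reflexive eq) z≤n

  <to : ∀ v → own v < to v
  <to v with outgoing v
  ... | parent (_ , v≺b) eq = ≤-trans (near 3 2 v≺b) (≤-reflexive (sym eq))
  ... | sibling s eq        = ≤-trans (block-mono 3 (≤-lastChild (inj₁ refl))) (≤-reflexive (sym eq))
  ... | nothing _ eq        = ≤-trans (s≤s (s≤s (s≤s (≤-trans (*-monoʳ-≤ 4 (≤-maximum pos v)) (n≤1+n _))))) (≤-reflexive (sym eq))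

  shape : Vertex → Shape
  shape v = record
    { axis = axisOf v ; start = start v ; mid = own v ; end = end v ; from = from v ; to = to v
    ; start≤mid = start≤own v ; mid≤end = own≤end v ; from≤to = ≤-trans (from≤own v) (<⇒≤ (<to v))
    }

  -- Adjacent vertices share a grid edge

  Common : Vertex → Vertex → Set
  Common u v = ∃[ b ] ∃[ ℓ ] ∃[ j ] Occupies (shape u) b ℓ j × Occupies (shape v) b ℓ j

  common-sym : ∀ {u v} → Common u v → Common v u
  common-sym (b , ℓ , j , o , o′) = b , ℓ , j , o′ , o

  -- The shared unit ends at `own v` on the line of a. That line reaches it because a right parent
  -- of a lies beyond v, and `meet a` lies beyond every child of a on the right.
  leftParent-common : ∀ {v a} → LeftParent v a → Common a v
  leftParent-common {v} {a} lp@(p , a≺v) = axisOf a , own a , 1 + block v ,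
    middle refl refl (≤-trans (from≤own a) (near 2 1 a≺v)) reaches ,
    first (parent-axis p) (sym (from-parent lp)) (start-parent lp) ≤-refl
    where
    reaches : own v ≤ to a
    reaches with outgoing a
    ... | parent (q , a≺b) eq = ≤-trans (near 2 2 (inner-right p a≺v a≺b (parent-≤ q))) (≤-reflexive (sym eq))
    ... | sibling s eq        = ≤-trans (≤-trans (within 2 3 v) (block-mono 3 (≤-lastChild (inj₂ lp)))) (≤-reflexive (sym eq))
    ... | nothing _ eq        = ≤-trans (s≤s (s≤s (≤-trans (*-monoʳ-≤ 4 (≤-maximum pos v)) (m≤n+m _ 2)))) (≤-reflexive (sym eq))

  rightParent-common : ∀ {v b} → RightParent v b → Common b v
  -- The unit starts at offset 3, not 2: if v is the last child of the left sibling w of b, the line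
  -- of b may begin only at `meet w`, which then has offset 3.
  rightParent-common {v} {b} rp@(p , v≺b) = axisOf b , own b , 3 + block v ,
    middle refl refl reaches (≤-trans (near 4 2 v≺b) (<⇒≤ (<to b))) ,
    last (parent-axis p) (sym (to-parent rp)) (within 2 3 v) (end-parent rp)
    where
    reaches : from b ≤ 3 + block v
    reaches with incoming b
    ... | parent (q , a≺b) eq = ≤-trans (≤-reflexive eq) (near 2 3 (inner-left p v≺b a≺b (parent-≤ q)))
    ... | nothing _ eq        = ≤-trans (≤-reflexive eq) z≤n
    ... | sibling {w} s@((_ , same-layer) , w≺b) eq = ≤-trans (≤-reflexive eq) (block-mono 3 (go (proj₁ (proj₂ (lastChildOf w)))))
      where
      w≺v : w ≺ v
      w≺v = inner-left p v≺b w≺b (≤-reflexive (sym same-layer))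
      go : ∀ {d} → OuterChild w d → pos d ≤ pos v
      go (inj₁ refl) = <⇒≤ w≺v
      go {d} (inj₂ (q , w≺d)) with order d v
      ... | before d≺v = <⇒≤ d≺v
      ... | same refl  = ≤-refl
      ... | behind v≺d = ⊥-elim (no-crossing w≺v v≺d (inner-right q w≺d w≺b (≤-reflexive same-layer)) (~-sym (proj₁ q)) (proj₁ p))

  -- A left parent of v or a right parent of w is shared by both, and its line carries the overlap.
  -- Otherwise the facing ends are both free to use the line `meet w`.
  sibling-common : ∀ {v w} → LeftSibling v w → Common w v
  sibling-common {v} {w} ls@(s , w≺v) with leftParent? v | rightParent? w
  ... | yes (a , p) | _ = not (axisOf w) , own a , 1 + block w ,
          first refl (sym (from-parent (share-left ls p))) (start-parent (share-left ls p)) ≤-refl ,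
          first (cong not (sym (sibling-axis s))) (sym (from-parent p)) (≤-reflexive (start-sibling ls)) (near 2 2 w≺v)
  ... | no _ | yes (b , p) = not (axisOf w) , own b , 3 + block v ,
          last refl (sym (to-parent p)) (near 2 3 w≺v) (≤-reflexive (sym (end-sibling (swapˡ ls)))) ,
          last (cong not (sym (sibling-axis s))) (sym (to-parent (share-right (swapˡ ls) p))) (within 2 3 v) (end-parent (share-right (swapˡ ls) p))
  ... | no ¬p | no ¬q = not (axisOf w) , meet w , own w ,
          last refl (sym (to-sibling ¬q (swapˡ ls))) ≤-refl (≤-trans (near 3 4 w≺v) (≤-reflexive (sym (end-sibling (swapˡ ls))))) ,
          first (cong not (sym (sibling-axis s))) (sym (from-sibling ¬p ls)) (≤-trans (≤-reflexive (start-sibling ls)) (within 1 2 w)) (near 3 2 w≺v)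

  adjacent⇒common : ∀ {u v} → u ~ v → Common u v
  adjacent⇒common {u} {v} u~v with order u v | <-cmp (layer u) (layer v)
  ... | same u≡v   | _ = contradiction u≡v (~⇒≢ u~v)
  ... | before u≺v | tri≈ _ eq _ = sibling-common ((~-sym u~v , sym eq) , u≺v)
  ... | behind v≺u | tri≈ _ eq _ = common-sym (sibling-common ((u~v , eq) , v≺u))
  ... | before u≺v | tri< lt _ _ = leftParent-common ((~-sym u~v , ≤-antisym (layer-step (~-sym u~v)) lt) , u≺v)
  ... | behind v≺u | tri< lt _ _ = rightParent-common ((~-sym u~v , ≤-antisym (layer-step (~-sym u~v)) lt) , v≺u)
  ... | before u≺v | tri> _ _ gt = common-sym (rightParent-common ((u~v , ≤-antisym (layer-step u~v) gt) , u≺v))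
  ... | behind v≺u | tri> _ _ gt = common-sym (leftParent-common ((u~v , ≤-antisym (layer-step u~v) gt) , v≺u))

  -- Vertices that share a grid edge are adjacent

  start-after : ∀ {v a} → LeftParent v a → block a ≤ start v
  start-after {v} {a} lp@(_ , a≺v) with start-≥ v
  ... | inj₁ (w , s , eq) = ≤-trans (near 0 1 (proj₂ (share-left s lp))) (≤-reflexive (sym eq))
  ... | inj₂ le           = ≤-trans (near 0 1 a≺v) le

  end-before : ∀ {v b} → RightParent v b → end v ≤ block b
  end-before {v} {b} rp@(_ , v≺b) with end-≤ v
  ... | inj₁ (w , s , eq) = ≤-trans (≤-reflexive eq) (near 4 0 (proj₂ (share-right s rp)))
  ... | inj₂ le           = ≤-trans le (near 4 0 v≺b)

  -- To begin before the line of u, the segment must reach back to a left sibling w of v. If w is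
  -- not u, then either u lies under the edge wv, or w lies to the right of u and the segment starts
  -- too late.
  left-overlap : ∀ {u v j} → layer u ≡ layer v → u ≺ v → start v ≤ j → j < own u → u ~ v
  left-overlap {u} {v} {j} eq u≺v s≤j j<u with start-≥ v
  ... | inj₂ le = contradiction (≤-trans le (≤-trans s≤j (s≤s⁻¹ j<u))) (<⇒≱ (near 2 1 u≺v))
  ... | inj₁ (w , ((v~w , eq′) , w≺v) , eqₛ) with order w u
  ...   | same refl  = ~-sym v~w
  ...   | before w≺u = ⊥-elim (covered (~-sym v~w) w≺u u≺v (≤-reflexive (trans eq eq′)) (≤-reflexive eq))
  ...   | behind u≺w = contradiction (≤-trans (≤-reflexive (sym eqₛ)) (≤-trans s≤j (s≤s⁻¹ j<u))) (<⇒≱ (near 2 1 u≺w))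

  right-overlap : ∀ {u v j} → layer u ≡ layer v → u ≺ v → own v ≤ j → j < end u → u ~ v
  right-overlap {u} {v} {j} eq u≺v v≤j j<e with end-≤ u
  ... | inj₂ le = contradiction (≤-trans (s≤s v≤j) (≤-trans j<e le)) (<⇒≱ (near 5 3 u≺v))
  ... | inj₁ (w , ((u~w , eq′) , u≺w) , eqₑ) with order w v
  ...   | same refl  = u~w
  ...   | behind v≺w = ⊥-elim (covered u~w u≺v v≺w (≤-reflexive (sym eq)) (≤-reflexive (trans (sym eq) eq′)))
  ...   | before w≺v = contradiction (≤-trans (s≤s v≤j) (≤-trans j<e (≤-reflexive eqₑ))) (<⇒≱ (near 5 3 w≺v))

  same-parent : ∀ {u v a} → Parent u a → Parent v a → layer u ≡ layer v
  same-parent (_ , eq) (_ , eq′) = trans eq (sym eq′)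

  -- A free end is empty, and `own` and `meet` lines never coincide. A common parent leads to
  -- `left-overlap`; a common meeting line would give one vertex two right siblings.
  first-first : ∀ {u v j} → u ≢ v → axisOf u ≡ axisOf v → from u ≡ from v →
    start u ≤ j → j < own u → start v ≤ j → j < own v → u ~ v
  first-first {u} {v} u≢v axes eq s j<u s′ j<v with incoming u | incoming v
  ... | nothing e _ | _           = contradiction (≤-trans (≤-reflexive (sym e)) s) (<⇒≱ j<u)
  ... | _           | nothing e _ = contradiction (≤-trans (≤-reflexive (sym e)) s′) (<⇒≱ j<v)
  ... | parent _ e  | sibling _ e′ = contradiction (trans (sym e) (trans eq e′)) own≢meet
  ... | sibling _ e | parent _ e′  = contradiction (trans (sym e′) (trans (sym eq) e)) own≢meet
  ... | sibling {w} t e | sibling {w′} t′ e′ with meet-injective {w} {w′}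
          (trans (sym (sibling-axis (proj₁ t))) (trans axes (sibling-axis (proj₁ t′)))) (trans (sym e) (trans eq e′))
  ...   | refl = contradiction (rightSibling-unique (swapˡ t) (swapˡ t′)) u≢v
  first-first {u} {v} u≢v axes eq s j<u s′ j<v | parent p e | parent p′ e′
    with block-injective 2 (trans (sym e) (trans eq e′))
  ... | refl with order u v
  ...   | before u≺v = left-overlap (same-parent (proj₁ p) (proj₁ p′)) u≺v s′ j<u
  ...   | same u≡v   = contradiction u≡v u≢v
  ...   | behind v≺u = ~-sym (left-overlap (same-parent (proj₁ p′) (proj₁ p)) v≺u s j<v)

  last-last : ∀ {u v j} → u ≢ v → axisOf u ≡ axisOf v → to u ≡ to v →
    own u ≤ j → j < end u → own v ≤ j → j < end v → u ~ v
  last-last {u} {v} u≢v axes eq u≤j e v≤j e′ with outgoing u | outgoing v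
  ... | nothing q _ | _           = contradiction (≤-trans e (≤-reflexive q)) (≤⇒≯ u≤j)
  ... | _           | nothing q _ = contradiction (≤-trans e′ (≤-reflexive q)) (≤⇒≯ v≤j)
  ... | parent _ q  | sibling _ q′ = contradiction (trans (sym q) (trans eq q′)) own≢meet
  ... | sibling _ q | parent _ q′  = contradiction (trans (sym q′) (trans (sym eq) q)) own≢meet
  ... | sibling _ q | sibling _ q′ = contradiction (meet-injective axes (trans (sym q) (trans eq q′))) u≢v
  ... | parent p q  | parent p′ q′ with block-injective 2 (trans (sym q) (trans eq q′))
  ...   | refl with order u v
  ...     | before u≺v = right-overlap (same-parent (proj₁ p) (proj₁ p′)) u≺v v≤j e
  ...     | same u≡v   = contradiction u≡v u≢v
  ...     | behind v≺u = ~-sym (right-overlap (same-parent (proj₁ p′) (proj₁ p)) v≺u u≤j e′)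

  -- On the line of a common parent the two segments lie on opposite sides of that parent, by
  -- `start-after` and `end-before`. On a meeting line, v must be the left sibling of u.
  first-last : ∀ {u v j} → axisOf u ≡ axisOf v → from u ≡ to v →
    start u ≤ j → j < own u → own v ≤ j → j < end v → u ~ v
  first-last {u} {v} axes eq s j<u v≤j e with incoming u | outgoing v
  ... | nothing q _ | _           = contradiction (≤-trans (≤-reflexive (sym q)) s) (<⇒≱ j<u)
  ... | _           | nothing q _ = contradiction (≤-trans e (≤-reflexive q)) (≤⇒≯ v≤j)
  ... | parent _ q  | sibling _ q′ = contradiction (trans (sym q) (trans eq q′)) own≢meet
  ... | sibling _ q | parent _ q′  = contradiction (trans (sym q′) (trans (sym eq) q)) own≢meet
  ... | parent p q  | parent p′ q′ with block-injective 2 (trans (sym q) (trans eq q′))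
  ...   | refl = contradiction (≤-trans (end-before p′) (≤-trans (start-after p) s)) (<⇒≱ e)
  first-last {u} {v} axes eq s j<u v≤j e | sibling {w} t q | sibling _ q′
    with meet-injective {w} {v} (trans (sym (sibling-axis (proj₁ t))) axes) (trans (sym q) (trans eq q′))
  ... | refl = proj₁ (proj₁ t)

  first-middle : ∀ {u v j} → from u ≡ own v → start u ≤ j → j < own u → u ~ v
  first-middle {u} {v} eq s j<u with incoming u
  ... | nothing q _ = contradiction (≤-trans (≤-reflexive (sym q)) s) (<⇒≱ j<u)
  ... | sibling _ q = contradiction (trans (sym eq) q) own≢meet
  ... | parent p q with block-injective 2 (trans (sym q) eq)
  ...   | refl = proj₁ (proj₁ p)

  last-middle : ∀ {u v j} → to u ≡ own v → own u ≤ j → j < end u → u ~ v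
  last-middle {u} {v} eq u≤j e with outgoing u
  ... | nothing q _ = contradiction (≤-trans e (≤-reflexive q)) (≤⇒≯ u≤j)
  ... | sibling _ q = contradiction (trans (sym eq) q) own≢meet
  ... | parent p q with block-injective 2 (trans (sym q) eq)
  ...   | refl = proj₁ (proj₁ p)

  common⇒adjacent : ∀ {u v} → u ≢ v → Common u v → u ~ v
  common⇒adjacent u≢v (_ , _ , _ , first b ℓ s t , first b′ ℓ′ s′ t′) =
    first-first u≢v (not-injective (trans (sym b) b′)) (trans (sym ℓ) ℓ′) s t s′ t′
  common⇒adjacent u≢v (_ , _ , _ , first b ℓ s t , last b′ ℓ′ s′ t′) =
    first-last (not-injective (trans (sym b) b′)) (trans (sym ℓ) ℓ′) s t s′ t′
  common⇒adjacent u≢v (_ , _ , _ , last b ℓ s t , first b′ ℓ′ s′ t′) =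
    ~-sym (first-last (not-injective (trans (sym b′) b)) (trans (sym ℓ′) ℓ) s′ t′ s t)
  common⇒adjacent u≢v (_ , _ , _ , last b ℓ s t , last b′ ℓ′ s′ t′) =
    last-last u≢v (not-injective (trans (sym b) b′)) (trans (sym ℓ) ℓ′) s t s′ t′
  common⇒adjacent u≢v (_ , _ , _ , first b ℓ s t , middle b′ ℓ′ _ _) = first-middle (trans (sym ℓ) ℓ′) s t
  common⇒adjacent u≢v (_ , _ , _ , last b ℓ s t , middle b′ ℓ′ _ _)  = last-middle (trans (sym ℓ) ℓ′) s t
  common⇒adjacent u≢v (_ , _ , _ , middle b ℓ _ _ , first b′ ℓ′ s t) = ~-sym (first-middle (trans (sym ℓ′) ℓ) s t)
  common⇒adjacent u≢v (_ , _ , _ , middle b ℓ _ _ , last b′ ℓ′ s t)  = ~-sym (last-middle (trans (sym ℓ′) ℓ) s t)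
  common⇒adjacent u≢v (_ , _ , _ , middle b ℓ _ _ , middle b′ ℓ′ _ _) = contradiction (block-injective 2 (trans (sym ℓ) ℓ′)) u≢v

  representation : G ∈Bᵐ 2
  representation = record
    { b-epg = record
      { epg = record
        { path     = toPath ∘ shape
        ; adjacent = λ u v u≢v → mk⇔
            (Equivalence.from (toPath-intersect (shape u) (shape v)) ∘ adjacent⇒common)
            (common⇒adjacent u≢v ∘ Equivalence.to (toPath-intersect (shape u) (shape v)))
        }
      ; fewBends = toPath-bends ∘ shape
      }
    ; monotonic = toPath-monotonic ∘ shape
    }

-- The order of first visits on the outer walks

module OnePage (G : Graph) (O : OuterplaneEmbedding G) where
  open Graph G using (Vertex; _~_)
  open OuterplaneEmbedding O using (component; components; onOuter)
  open Layers G components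
  open OuterWalk G O

  time : Vertex → ℕ
  time v = proj₁ (visit v)

  time-visit : ∀ {k v} → component v ≡ k → FirstVisit k v (time v)
  time-visit {v = v} refl = proj₂ (visit v)

  width : ℕ
  width = suc (maximum time)

  -- Components occupy disjoint intervals, since `width` exceeds every time.
  pos : Vertex → ℕ
  pos v = toℕ (component v) * width + time v

  component-< : ∀ {u v} → toℕ (component u) < toℕ (component v) → pos u < pos v
  component-< {u} {v} lt = begin-strict
    toℕ (component u) * width + time u  <⟨ +-monoʳ-< (toℕ (component u) * width) (s≤s (≤-maximum time u)) ⟩
    toℕ (component u) * width + width   ≡⟨ +-comm (toℕ (component u) * width) width ⟩
    suc (toℕ (component u)) * width     ≤⟨ *-monoˡ-≤ width lt ⟩
    toℕ (component v) * width           ≤⟨ m≤m+n _ (time v) ⟩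
    pos v                               ∎
    where open ≤-Reasoning

  pos-cancel : ∀ {u v} → component u ≡ component v → pos u < pos v → time u < time v
  pos-cancel {u} {v} eq lt = +-cancelˡ-< (toℕ (component v) * width) (time u) (time v)
    (subst (λ k → toℕ k * width + time u < pos v) eq lt)

  pos-injective : ∀ {u v} → pos u ≡ pos v → u ≡ v
  pos-injective {u} {v} eq with <-cmp (toℕ (component u)) (toℕ (component v))
  ... | tri< lt _ _ = contradiction eq (<⇒≢ (component-< lt))
  ... | tri> _ _ gt = contradiction (sym eq) (<⇒≢ (component-< gt))
  ... | tri≈ _ k≡ _ = trans (sym (proj₁ (time-visit (Fin.toℕ-injective k≡))))
      (trans (cong (λ m → origin G (walk (component v) m)) times) (proj₁ (time-visit refl)))
    where
    times : time u ≡ time v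
    times = +-cancelˡ-≡ (toℕ (component v) * width) (time u) (time v)
      (subst (λ k → k * width + time u ≡ pos v) k≡ eq)

  between : ∀ {a x c} → component a ≡ component c → pos a < pos x → pos x < pos c → component x ≡ component a
  between {a} {x} {c} eq a<x x<c with <-cmp (toℕ (component x)) (toℕ (component a))
  ... | tri< lt _ _ = contradiction (component-< lt) (<-asym a<x)
  ... | tri≈ _ k≡ _ = Fin.toℕ-injective k≡
  ... | tri> _ _ gt = contradiction (component-< (subst (λ k → toℕ k < toℕ (component x)) eq gt)) (<-asym x<c)

  pos-no-crossing : ∀ {a b c d} → pos a < pos b → pos b < pos c → pos c < pos d → a ~ c → b ~ d → ⊥
  pos-no-crossing {a} {b} {c} {d} a<b b<c c<d a~c b~d = no-crossing
    (time-visit refl) (time-visit b≡a) (time-visit c≡a) (time-visit d≡a)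
    (pos-cancel (sym b≡a) a<b) (pos-cancel (trans b≡a (sym c≡a)) b<c) (pos-cancel (trans c≡a (sym d≡a)) c<d) a~c b~d
    where
    c≡a = sym (~⇒component a~c)
    b≡a = between (~⇒component a~c) a<b b<c
    d≡a = trans (sym (~⇒component b~d)) b≡a

  -- An edge over x would have an end in the same component visited before x, but the walk of that
  -- component starts at its root x.
  root-uncovered : ∀ {a x c} → layer x ≡ 0 → a ~ c → pos a < pos x → pos x < pos c → ⊥
  root-uncovered {a} {x} {c} z a~c a<x x<c = proj₂ (visit x) .proj₂ first-at-0 starts
    where
    first-at-0 : 0 < time x
    first-at-0 = ≤-trans (s≤s z≤n) (pos-cancel (sym (between (~⇒component a~c) a<x x<c)) a<x)

    starts : origin G (walk (component x) 0) ≡ x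
    starts = trans (proj₁ (proj₂ (onOuter (root x)))) (sym (layer-zero z))

  layering : OnePageLayering G
  layering = record
    { pos = pos ; pos-injective = pos-injective ; no-crossing = pos-no-crossing
    ; layer = layer ; layer-suc = layer-suc ; layer-step = layer-step ; uncovered = root-uncovered
    }

theorem2p7 : (G : Graph) → Outerplanar G → G ∈Bᵐ 2
theorem2p7 G O = Layout.representation G (OnePage.layering G O)
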